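{- Let $P(z)=\sum_{n\ge0}P_nz^n$ be the unique formal power series satisfying $P=1+\frac{zP^2}{1-z^3P^2}$, and let $Q_n$ be as in the context. For every $n>0$, $$P_n=\sum_{0\le k<n/3}\frac{1}{n-k+1}\binom{n-2k-1}{k}\binom{2n-4k}{n-3k},$$ $$Q_n=\sum_{\substack{0\le s\le k,\\ 0\le k<n/3}}\frac{3(k-s)+2}{n-s+1}\binom{n-3k+s-2}{s}\binom{2n-3k-s-1}{n-3k-1},$$ where $k$ and $s$ range over integers.
   Context: For $n\ge1$, fix a convex $(n+2)$-gon with vertices labelled $0,1,\dots,n+1$ in cyclic order. A dissection is a set of pairwise non-crossing diagonals (chords); these partition the polygon into sub-polygons (cells). The quiddity of a dissection is the tuple $(a_0,\dots,a_{n+1})$ with $a_i$ the number of cells having vertex $i$. A dissection is 3-periodic if every cell has a number of vertices divisible by $3$. $Q_n$ is the number of distinct tuples occurring as quiddities of 3-periodic dissections of the $(n+2)$-gon. -}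

module Defs where

open import Data.Nat using (ℕ; zero; suc; _+_; _*_; _∸_; _<_; _≤_; _<?_)
open import Data.Nat.Combinatorics using (_C_)
open import Data.Nat.Divisibility using (_∣_)
open import Data.Integer using (+_)
open import Data.Rational using (ℚ; 0ℚ; 1ℚ; _/_) renaming (_+_ to _+ℚ_; _*_ to _*ℚ_; _-_ to _-ℚ_)
open import Data.List using (List; []; _∷_; _++_; length)
open import Data.List.Membership.Propositional using (_∈_)
open import Data.List.Relation.Unary.All using (All)
open import Data.List.Relation.Unary.AllPairs using (AllPairs)
open import Data.List.Relation.Unary.Unique.Propositional using (Unique)
open import Data.Vec using (Vec; lookup)
open import Data.Fin using (Fin; toℕ)
open import Data.Product using (Σ; _×_; _,_; ∃)
open import Data.Sum using (_⊎_)
open import Relation.Nullary using (¬_; does)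
open import Relation.Binary.PropositionalEquality using (_≡_; _≢_)
open import Function.Bundles using (_⇔_)
open import Data.Bool using (if_then_else_)

HasCount : {A : Set} → (A → Set) → ℕ → Set
HasCount {A} P k =
  Σ (List A) λ L → Unique L × length L ≡ k × (∀ x → (x ∈ L) ⇔ P x)

-- Dissections of a convex N-gon with vertices 0,…,N-1 (cyclic order).
-- A chord is written (i , j) with i < j.

Chord : Set
Chord = ℕ × ℕ

IsSide : ℕ → Chord → Set
IsSide N (i , j) = (suc i ≡ j) ⊎ ((i ≡ 0) × (suc j ≡ N))

IsDiagonal : ℕ → Chord → Set
IsDiagonal N (i , j) = (i < j) × (j < N) × ¬ IsSide N (i , j)

Cross : Chord → Chord → Set
Cross (a , b) (c , d) = ((a < c) × (c < b) × (b < d)) ⊎ ((c < a) × (a < d) × (d < b))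

record Dissection (N : ℕ) : Set where
  field
    chords     : List Chord
    diagonals  : All (IsDiagonal N) chords
    distinct   : Unique chords
    noncrossing : AllPairs (λ c d → ¬ Cross c d) chords
open Dissection public

consec : List ℕ → List Chord
consec (x ∷ y ∷ r) = (x , y) ∷ consec (y ∷ r)
consec _ = []

lastOf : ℕ → List ℕ → ℕ
lastOf x [] = x
lastOf x (y ∷ ys) = lastOf y ys

cycPairs : List ℕ → List Chord
cycPairs [] = []
cycPairs (x ∷ []) = []
cycPairs (x ∷ y ∷ ys) = consec (x ∷ y ∷ ys) ++ ((x , lastOf y ys) ∷ [])

-- A cell of the dissection, given by its vertex list in increasing order:
-- at least 3 vertices, and two of its vertices u < w are joined by a side
-- of the polygon or a chord of the dissection exactly when they are
-- cyclically consecutive vertices of the cell (i.e. the boundary of the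
-- convex sub-polygon consists of sides/chords, and no chord lies inside).
IsCell : {N : ℕ} → Dissection N → List ℕ → Set
IsCell {N} D V =
  AllPairs _<_ V × All (_< N) V × (3 ≤ length V) ×
  (∀ u w → u ∈ V → w ∈ V → u < w →
     ((u , w) ∈ cycPairs V) ⇔ (IsSide N (u , w) ⊎ (u , w) ∈ chords D))

ThreePeriodic : {N : ℕ} → Dissection N → Set
ThreePeriodic D = ∀ V → IsCell D V → 3 ∣ length V

IsQuiddity : {N : ℕ} → Dissection N → Vec ℕ N → Set
IsQuiddity {N} D a =
  ∀ (i : Fin N) → HasCount (λ V → IsCell D V × (toℕ i ∈ V)) (lookup a i)

IsQ : ℕ → ℕ → Set
IsQ n q = HasCount (λ (a : Vec ℕ (n + 2)) →
                      ∃ λ (D : Dissection (n + 2)) → ThreePeriodic D × IsQuiddity D a) q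

Series : Set
Series = ℕ → ℚ

Σ< : ℕ → (ℕ → ℚ) → ℚ
Σ< zero f = 0ℚ
Σ< (suc m) f = Σ< m f +ℚ f m

oneS : Series
oneS zero = 1ℚ
oneS (suc n) = 0ℚ

_⊕_ : Series → Series → Series
(f ⊕ g) n = f n +ℚ g n

_⊖_ : Series → Series → Series
(f ⊖ g) n = f n -ℚ g n

_⊛_ : Series → Series → Series
(f ⊛ g) n = Σ< (suc n) (λ i → f i *ℚ g (n ∸ i))

zpow : ℕ → Series → Series
zpow zero f = f
zpow (suc k) f zero = 0ℚ
zpow (suc k) f (suc n) = zpow k f n

-- P = 1 + z P² / (1 - z³ P²), with the denominator cleared
-- (1 - z³P² is invertible, having constant term 1):
-- (P - 1)(1 - z³ P²) = z P²
IsP : Series → Set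
IsP P = ∀ n → ((P ⊖ oneS) ⊛ (oneS ⊖ zpow 3 (P ⊛ P))) n ≡ zpow 1 (P ⊛ P) n

ℕtoℚ : ℕ → ℚ
ℕtoℚ m = + m / 1

Pformula : ℕ → ℚ
Pformula n = Σ< n λ k →
  if does (3 * k <? n)
  then ((+ 1 / suc (n ∸ k)) *ℚ ℕtoℚ ((n ∸ 2 * k ∸ 1) C k))
         *ℚ ℕtoℚ ((2 * n ∸ 4 * k) C (n ∸ 3 * k))
  else 0ℚ

-- Σ_{0 ≤ s ≤ k, 0 ≤ k < n/3}
--   (3(k-s)+2)/(n-s+1) · C(n-3k+s-2,s) · C(2n-3k-s-1,n-3k-1)
-- (the upper index n-3k+s-2 equals -1 only when s = 0, where C(-1,0) = 1;
--  truncated subtraction gives C(0,0) = 1, the same value)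
Qformula : ℕ → ℚ
Qformula n = Σ< n λ k →
  if does (3 * k <? n)
  then Σ< (suc k) (λ s →
         ((+ (3 * (k ∸ s) + 2) / suc (n ∸ s))
            *ℚ ℕtoℚ ((n + s ∸ (3 * k + 2)) C s))
            *ℚ ℕtoℚ ((2 * n ∸ (3 * k + s + 1)) C (n ∸ (3 * k + 1))))
  else 0ℚ

{-# OPTIONS --safe #-}

-- Write a 3-periodic dissection as a plane tree (cells = inner vertices, sides other than the root
-- side = leaves) and encode a tuple (a_0,…,a_{n+1}) as the word T^{a_0} S T^{a_1} S ⋯ S T^{a_{n+1}}.
-- The word of a leaf is S and that of a cell with children t_1,…,t_k, k ≡ 2 mod 3, is
-- T t_1 T t_2 T ⋯ T t_k T.  Different trees may give the same word; regrouping letters brings every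
-- tree to a canonical form in which, below the root, every third child of a cell is a leaf, and the
-- words of canonical trees are uniquely parsable.  So Q_n counts canonical trees with n+1 leaves.
-- A non-root subtree of such a tree is S or v = T b T c T (1 + S v), whence its generating function
-- is z P(z), and Q(z) = Σ_j z^{3j+1} P^{3j+2}.  Refining P by P = 1 + x P² / (1 - w P²), the
-- coefficient of x^i w^s in P^a is a/(a+i+2s) C(i+s-1,s) C(a-1+2i+2s,i): both sides satisfy
-- P^{a+1} = P^a + x P^{a+2} + w P^{a+3} - w P^{a+2}.  At x = z, w = z³ this gives both formulas.
module Submission where

open import Defs
open import Algebra.Properties.Group using (∙-cancelˡ)
open import Data.Bool using (if_then_else_)
open import Data.Empty using (⊥; ⊥-elim)
open import Data.Fin using (fromℕ<; toℕ)
open import Data.Fin.Properties using (toℕ-fromℕ<)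
open import Data.Integer as ℤ using () renaming (+_ to pos)
import Data.Integer.Properties as ℤₚ
open import Data.List using (List; []; _∷_; _++_; length; map; filter)
open import Data.List.Membership.Propositional using (_∈_; _∉_)
open import Data.List.Membership.Propositional.Properties using (∈-++⁺ˡ; ∈-++⁺ʳ; ∈-++⁻; ∈-map⁺; ∈-map⁻; ∈-filter⁺; ∈-filter⁻)
open import Data.List.Membership.Propositional.Properties.WithK using (unique∧set⇒bag)
open import Data.List.Properties using (++-assoc; ++-identityʳ; length-++; length-map; map-++; ∷-injectiveˡ; ∷-injectiveʳ)
open import Data.List.Relation.Binary.BagAndSetEquality using (∼bag⇒↭)
open import Data.List.Relation.Binary.Permutation.Propositional.Properties using (↭-length)
open import Data.List.Relation.Unary.All as All using (All; []; _∷_)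
import Data.List.Relation.Unary.All.Properties as Allₚ
open import Data.List.Relation.Unary.AllPairs as AllPairs using (AllPairs; []; _∷_)
import Data.List.Relation.Unary.AllPairs.Properties as AllPairsₚ
open import Data.List.Relation.Unary.Any using (here; there)
open import Data.List.Relation.Unary.Unique.Propositional using (Unique)
import Data.List.Relation.Unary.Unique.Propositional.Properties as Uniqueₚ
open import Data.Nat
open import Data.Nat.Combinatorics using (_C_; nCk≡n!/k![n-k]!; k![n∸k]!∣n!; k>n⇒nCk≡0)
open import Data.Nat.Divisibility using (_∣_; divides; ∣⇒≤; ∣m+n∣m⇒∣n; ∣m∣n⇒∣m+n; ∣-refl; >⇒∤; _∣0)
open import Data.Nat.DivMod using (m/n*n≡m)
open import Data.Nat.Induction using (<-rec)
open import Data.Nat.ListAction using (sum)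
open import Data.Nat.ListAction.Properties using (sum-++)
open import Data.Nat.Properties
open import Data.Nat.Tactic.RingSolver using (solve-∀)
open import Data.Product using (Σ; _×_; _,_; ∃; proj₁; proj₂)
open import Data.Product.Properties using (≡-dec)
open import Data.Rational using (ℚ; 0ℚ; 1ℚ; toℚᵘ) renaming (_/_ to _/ℚ_; _+_ to _+ℚ_; _*_ to _*ℚ_; _-_ to _-ℚ_; -_ to neg)
import Data.Rational.Properties as ℚₚ
open import Data.Rational.Solver using (module +-*-Solver)
open import Data.Rational.Unnormalised as ℚᵘ using (mkℚᵘ; *≡*)
import Data.Rational.Unnormalised.Properties as ℚᵘₚ
open import Data.Sum using (_⊎_; inj₁; inj₂)
open import Data.Unit using (⊤; tt)
open import Data.Vec using (Vec; []; _∷_; lookup; tabulate; toList; fromList)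
open import Data.Vec.Properties using (lookup∘tabulate; tabulate∘lookup; tabulate-cong; toList∘fromList; length-toList)
open import Function.Bundles using (_⇔_; mk⇔; Equivalence)
open import Function.Construct.Symmetry using (⇔-sym)
open import Relation.Binary.PropositionalEquality
import Relation.Binary.Reasoning.Setoid ℚᵘₚ.≃-setoid as ≃-Reasoning
open import Relation.Nullary using (¬_; yes; no; contradiction; Dec; does)
open import Relation.Nullary.Decidable using (dec-true; dec-false)
open import Data.List.Membership.DecPropositional (≡-dec _≟_ _≟_) using (_∈?_)
open import Data.List.Membership.DecPropositional _≟_ using () renaming (_∈?_ to _∈ℕ?_)
open Equivalence using (to; from)

-- Words are ambiguous because the letters `T b T c T` that open a cell already spell a cell with
-- two children. If the third child `x` is a cell as well, the parent can take over `T b T c T`,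
-- then the children of `x`, then a cell made of the remaining children, whose number is again 2
-- modulo 3. Each of these pieces stands right after a `T` that was there anyway. The parent gains
-- one child more than `x` had, a multiple of 3, so 3-periodicity survives. A leaf in third place
-- forbids this reading by its `S`. The root has no parent to take anything over, so its own third
-- children stay unrestricted; hence the exponents 3j+2 in Q. The counts are not obtained by
-- Lagrange inversion. Opening the first node of a tuple of subtrees gives a recurrence that trades
-- a smaller `i` or `s` for a larger exponent, so all powers of P are carried together and the
-- closed form is checked against the recurrence.

-- Dissections as forests

-- A path of edges from vertex o to vertex e: each step is a side of the
-- polygon, or a chord (o , b) together with the dissection below it.
data Forest : ℕ → ℕ → Set where
  nil  : ∀ {o} → Forest o o
  side : ∀ {o e} → Forest (suc o) e → Forest o e
  sub  : ∀ {o b e} → Forest o b → Forest b e → Forest o e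

rest : ∀ {o e} → Forest o e → List ℕ
rest nil                = []
rest (side {o} F)       = suc o ∷ rest F
rest (sub {b = b} G F)  = b ∷ rest F

verts : ∀ {o e} → Forest o e → List ℕ
verts {o} F = o ∷ rest F

inner : ∀ {o e} → Forest o e → List (List ℕ)
inner nil       = []
inner (side F)  = inner F
inner (sub G F) = (verts G ∷ inner G) ++ inner F

cells : ∀ {o e} → Forest o e → List (List ℕ)
cells F = verts F ∷ inner F

chordsOf : ∀ {o e} → Forest o e → List Chord
chordsOf nil                   = []
chordsOf (side F)              = chordsOf F
chordsOf (sub {o} {b} G F)     = (o , b) ∷ chordsOf G ++ chordsOf F

Wide : ∀ {o e} → Forest o e → Set
Wide F = 2 ≤ length (rest F)

-- With fewer than two steps below it, a chord would be a single point, a side, or a repetition of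
-- the next chord inside.
Proper : ∀ {o e} → Forest o e → Set
Proper nil       = ⊤
Proper (side F)  = Proper F
Proper (sub G F) = Wide G × Proper G × Proper F

data Edge : ∀ {o e} → Forest o e → ℕ → ℕ → Set where
  side-here  : ∀ {o e} {F : Forest (suc o) e} → Edge (side F) o (suc o)
  side-there : ∀ {o e u w} {F : Forest (suc o) e} → Edge F u w → Edge (side F) u w
  sub-here   : ∀ {o b e} {G : Forest o b} {F : Forest b e} → Edge (sub G F) o b
  sub-in     : ∀ {o b e u w} {G : Forest o b} {F : Forest b e} → Edge G u w → Edge (sub G F) u w
  sub-there  : ∀ {o b e u w} {G : Forest o b} {F : Forest b e} → Edge F u w → Edge (sub G F) u w

-- The segment from `o` to `e` closes the outermost cell. It is the root side, or, for a part of a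
-- larger forest, the chord above that part. A wide proper forest does not list it among its edges
-- (`base-not-edge`).
EdgeOrBase : ∀ {o e} → Forest o e → ℕ → ℕ → Set
EdgeOrBase {o} {e} F u w = Edge F u w ⊎ (u ≡ o × w ≡ e)

steps-≤ : ∀ {o e} (F : Forest o e) → Proper F → length (rest F) + o ≤ e
steps-≤ nil _ = ≤-refl
steps-≤ {o} (side F) p = ≤-trans (≤-reflexive (sym (+-suc (length (rest F)) o))) (steps-≤ F p)
steps-≤ {o} (sub G F) (w , pG , pF) =
  ≤-trans (≤-reflexive (sym (+-suc (length (rest F)) o)))
    (≤-trans (+-monoʳ-≤ (length (rest F)) (≤-trans (+-monoˡ-≤ o (≤-trans (s≤s z≤n) w)) (steps-≤ G pG)))
      (steps-≤ F pF))

ends-≤ : ∀ {o e} (F : Forest o e) → Proper F → o ≤ e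
ends-≤ {o} F p = ≤-trans (m≤n+m o _) (steps-≤ F p)

wide-< : ∀ {o e} (F : Forest o e) → Proper F → Wide F → suc o < e
wide-< {o} F p w = ≤-trans (+-monoˡ-≤ o w) (steps-≤ F p)

edge-bounds : ∀ {o e u w} (F : Forest o e) → Proper F → Edge F u w → o ≤ u × u < w × w ≤ e
edge-bounds (side F) p side-here = ≤-refl , ≤-refl , ends-≤ F p
edge-bounds (side F) p (side-there x) with edge-bounds F p x
... | a , b , c = <⇒≤ a , b , c
edge-bounds (sub G F) (wd , pG , pF) sub-here = ≤-refl , <⇒≤ (wide-< G pG wd) , ends-≤ F pF
edge-bounds (sub G F) (wd , pG , pF) (sub-in x) with edge-bounds G pG x
... | a , b , c = a , b , ≤-trans c (ends-≤ F pF)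
edge-bounds (sub G F) (wd , pG , pF) (sub-there x) with edge-bounds F pF x
... | a , b , c = ≤-trans (ends-≤ G pG) a , b , c

-- Edges leaving `o` end no later than the first step does, and a wide path still has to advance
-- from there.
base-not-edge : ∀ {o e} (F : Forest o e) → Proper F → Wide F → ¬ Edge F o e
base-not-edge (side F) p (s≤s wd) side-here = <-irrefl refl (≤-trans (+-monoˡ-≤ _ wd) (steps-≤ F p))
base-not-edge (side F) p wd (side-there x) = <-irrefl refl (proj₁ (edge-bounds F p x))
base-not-edge (sub G F) (_ , pG , pF) (s≤s wd) sub-here =
  <-irrefl refl (≤-trans (+-monoˡ-≤ _ wd) (steps-≤ F pF))
base-not-edge (sub G F) (_ , pG , pF) (s≤s wd) (sub-in x) =
  <-irrefl refl (≤-trans (≤-trans (+-monoˡ-≤ _ wd) (steps-≤ F pF)) (proj₂ (proj₂ (edge-bounds G pG x))))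
base-not-edge (sub G F) (w , pG , pF) wd (sub-there x) =
  <-irrefl refl (≤-trans (<⇒≤ (wide-< G pG w)) (proj₁ (edge-bounds F pF x)))

Increasing : List ℕ → Set
Increasing = AllPairs _<_

Within : ℕ → ℕ → List ℕ → Set
Within o e V = ∀ {x} → x ∈ V → o ≤ x × x ≤ e

verts-within : ∀ {o e} (F : Forest o e) → Proper F → Within o e (verts F)
verts-within F p (here refl) = ≤-refl , ends-≤ F p
verts-within (side F) p (there i) with verts-within F p i
... | a , b = <⇒≤ a , b
verts-within (sub G F) (wd , pG , pF) (there i) with verts-within F pF i
... | a , b = ≤-trans (ends-≤ G pG) a , b

verts-increasing : ∀ {o e} (F : Forest o e) → Proper F → Increasing (verts F)
verts-increasing nil p = [] ∷ []
verts-increasing (side F) p =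
  All.tabulate (λ i → proj₁ (verts-within F p i)) ∷ verts-increasing F p
verts-increasing (sub G F) (wd , pG , pF) =
  All.tabulate (λ i → ≤-trans (<⇒≤ (wide-< G pG wd)) (proj₁ (verts-within F pF i))) ∷ verts-increasing F pF

consec-∈ : ∀ {u w} V → (u , w) ∈ consec V → u ∈ V × w ∈ V
consec-∈ (x ∷ y ∷ r) (here refl) = here refl , there (here refl)
consec-∈ (x ∷ y ∷ r) (there i) with consec-∈ (y ∷ r) i
... | a , b = there a , there b

consec-< : ∀ {u w} {V} → Increasing V → (u , w) ∈ consec V → u < w
consec-< {V = x ∷ y ∷ r} ((p ∷ _) ∷ _) (here refl) = p
consec-< {V = x ∷ y ∷ r} (_ ∷ inc) (there i) = consec-< inc i

lastOf-∈ : ∀ x xs → lastOf x xs ∈ x ∷ xs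
lastOf-∈ x [] = here refl
lastOf-∈ x (y ∷ ys) = there (lastOf-∈ y ys)

head-least : ∀ {x xs y} → Increasing (x ∷ xs) → y ∈ x ∷ xs → x ≤ y
head-least _ (here refl) = ≤-refl
head-least (a ∷ _) (there i) = <⇒≤ (All.lookup a i)

last-greatest : ∀ {x xs y} → Increasing (x ∷ xs) → y ∈ x ∷ xs → y ≤ lastOf x xs
last-greatest {xs = []} _ (here refl) = ≤-refl
last-greatest {xs = z ∷ zs} ((a ∷ _) ∷ inc) (here refl) = ≤-trans (<⇒≤ a) (last-greatest inc (here refl))
last-greatest {xs = z ∷ zs} (_ ∷ inc) (there i) = last-greatest inc i

lastOf-rest : ∀ {o e} (F : Forest o e) → lastOf o (rest F) ≡ e
lastOf-rest nil = refl
lastOf-rest (side F) = lastOf-rest F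
lastOf-rest (sub G F) = lastOf-rest F

consec⇒edge : ∀ {o e u w} (F : Forest o e) → (u , w) ∈ consec (verts F) → Edge F u w
consec⇒edge (side F) (here refl) = side-here
consec⇒edge (side F) (there i) = side-there (consec⇒edge F i)
consec⇒edge (sub G F) (here refl) = sub-here
consec⇒edge (sub G F) (there i) = sub-there (consec⇒edge F i)

-- An edge nested below a step lies between the ends of that step, where the path has no further
-- vertex. With both ends on the path it would span the whole step, which `base-not-edge` excludes.
edge⇒consec : ∀ {o e u w} (F : Forest o e) → Proper F → u ∈ verts F → w ∈ verts F →
              Edge F u w → (u , w) ∈ consec (verts F)
edge⇒consec (side F) p ui wi side-here = here refl
edge⇒consec (side F) p ui wi (side-there x) with edge-bounds F p x
edge⇒consec (side F) p (here refl) wi (side-there x) | a , b , c = contradiction a (<-irrefl refl)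
edge⇒consec (side F) p (there ui) (here refl) (side-there x) | a , b , c =
  contradiction (<-trans a b) (<-irrefl refl)
edge⇒consec (side F) p (there ui) (there wi) (side-there x) | a , b , c = there (edge⇒consec F p ui wi x)
edge⇒consec (sub G F) p ui wi sub-here = here refl
edge⇒consec (sub G F) (wd , pG , pF) ui wi (sub-in x) with edge-bounds G pG x
edge⇒consec (sub G F) (wd , pG , pF) (there ui) wi (sub-in x) | a , b , c =
  contradiction (≤-trans b (≤-trans c (proj₁ (verts-within F pF ui)))) (<-irrefl refl)
edge⇒consec (sub G F) (wd , pG , pF) (here refl) (here refl) (sub-in x) | a , b , c =
  contradiction b (<-irrefl refl)
edge⇒consec (sub G F) (wd , pG , pF) (here refl) (there wi) (sub-in x) | a , b , c
  with refl ← ≤-antisym c (proj₁ (verts-within F pF wi)) = contradiction x (base-not-edge G pG wd)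
edge⇒consec (sub G F) (wd , pG , pF) ui wi (sub-there x) with edge-bounds F pF x
edge⇒consec (sub G F) (wd , pG , pF) (here refl) wi (sub-there x) | a , b , c =
  contradiction (≤-trans (<⇒≤ (wide-< G pG wd)) a) (<-irrefl refl)
edge⇒consec (sub G F) (wd , pG , pF) (there ui) (here refl) (sub-there x) | a , b , c =
  contradiction (≤-trans b (≤-trans (ends-≤ G pG) a)) (<-irrefl refl)
edge⇒consec (sub G F) (wd , pG , pF) (there ui) (there wi) (sub-there x) | a , b , c =
  there (edge⇒consec F pF ui wi x)

-- The cells of a forest, recognised by their boundary

BoundaryIs : (ℕ → ℕ → Set) → List ℕ → Set
BoundaryIs R V = ∀ {u w} → u ∈ V → w ∈ V → u < w → ((u , w) ∈ cycPairs V) ⇔ R u w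

CellFor : (ℕ → ℕ → Set) → List ℕ → Set
CellFor R V = Increasing V × 3 ≤ length V × BoundaryIs R V

CellFor-cong : ∀ {R R′ V} → (∀ {u w} → u ∈ V → w ∈ V → u < w → R u w ⇔ R′ u w) →
               CellFor R V → CellFor R′ V
CellFor-cong h (inc , l , c) = inc , l , λ ui wi u<w →
  mk⇔ (λ m → to (h ui wi u<w) (to (c ui wi u<w) m)) (λ r → from (c ui wi u<w) (from (h ui wi u<w) r))

-- The edge is a chord with the cell below it. Having an edge and not just bounds is what
-- `cells-sound` needs: an inner cell containing both `o` and `e` would make the base an edge.
inner-span : ∀ {o e V} (F : Forest o e) → Proper F → V ∈ inner F →
             Σ (ℕ × ℕ) λ (x , y) → Edge F x y × Within x y V
inner-span (side F) p i with inner-span F p i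
... | xy , d , w = xy , side-there d , w
inner-span (sub {o} {b} G F) (wd , pG , pF) (here refl) = (o , b) , sub-here , verts-within G pG
inner-span (sub G F) (wd , pG , pF) (there i) with ∈-++⁻ (inner G) i
... | inj₁ j = let xy , d , w = inner-span G pG j in xy , sub-in d , w
... | inj₂ j = let xy , d , w = inner-span F pF j in xy , sub-there d , w

-- Being a cell depends only on the edges among the vertices of the list, so it can be decided in
-- the part of the forest where the list lies. Seen from `G` the chord above is the base; seen from
-- outside it is an edge.
sub-local-in : ∀ {o b e u w} (G : Forest o b) (F : Forest b e) → Proper (sub G F) →
               w ≤ b → u < w → EdgeOrBase G u w ⇔ Edge (sub G F) u w
sub-local-in {b = b} {u = u} {w} G F (wd , pG , pF) w≤b u<w = mk⇔ f g
  where
  f : EdgeOrBase G u w → Edge (sub G F) u w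
  f (inj₁ x) = sub-in x
  f (inj₂ (refl , refl)) = sub-here
  g : Edge (sub G F) u w → EdgeOrBase G u w
  g sub-here = inj₂ (refl , refl)
  g (sub-in x) = inj₁ x
  g (sub-there x) = contradiction (≤-trans u<w (≤-trans w≤b (proj₁ (edge-bounds F pF x)))) (<-irrefl refl)

sub-local-there : ∀ {o b e u w} (G : Forest o b) (F : Forest b e) → Proper (sub G F) →
                  b ≤ u → Edge F u w ⇔ Edge (sub G F) u w
sub-local-there {b = b} {u = u} {w} G F (wd , pG , pF) b≤u = mk⇔ sub-there g
  where
  g : Edge (sub G F) u w → Edge F u w
  g sub-here = contradiction (≤-trans (<⇒≤ (wide-< G pG wd)) b≤u) (<-irrefl refl)
  g (sub-in x) with edge-bounds G pG x
  ... | _ , y , z = contradiction (≤-trans y (≤-trans z b≤u)) (<-irrefl refl)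
  g (sub-there x) = x

side-local : ∀ {o e u w} (F : Forest (suc o) e) → suc o ≤ u → Edge F u w ⇔ Edge (side F) u w
side-local {u = u} {w} F so≤u = mk⇔ side-there g
  where
  g : Edge (side F) u w → Edge F u w
  g side-here = contradiction so≤u (<-irrefl refl)
  g (side-there x) = x

wide-cell : ∀ {o e} (F : Forest o e) → Proper F → Wide F → CellFor (EdgeOrBase F) (verts F)
wide-cell {o} {e} F p wd = verts-increasing F p , s≤s wd , bd F wd p
  where
  bd : ∀ {o e} (F : Forest o e) → Wide F → Proper F → BoundaryIs (EdgeOrBase F) (verts F)
  bd {o} {e} F wd p {u} {w} ui wi u<w with rest F in eq
  ... | y ∷ ys = mk⇔ f g
    where
    f : (u , w) ∈ consec (o ∷ y ∷ ys) ++ (o , lastOf y ys) ∷ [] → EdgeOrBase F u w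
    f m with ∈-++⁻ (consec (o ∷ y ∷ ys)) m
    ... | inj₁ i = inj₁ (consec⇒edge F (subst (λ r → (u , w) ∈ consec (o ∷ r)) (sym eq) i))
    ... | inj₂ (here refl) = inj₂ (refl , trans (cong (lastOf o) (sym eq)) (lastOf-rest F))
    g : EdgeOrBase F u w → (u , w) ∈ consec (o ∷ y ∷ ys) ++ (o , lastOf y ys) ∷ []
    g (inj₁ x) = ∈-++⁺ˡ (subst (λ r → (u , w) ∈ consec (o ∷ r)) eq
                  (edge⇒consec F p (subst (λ r → u ∈ o ∷ r) (sym eq) ui)
                                   (subst (λ r → w ∈ o ∷ r) (sym eq) wi) x))
    g (inj₂ (refl , refl)) = ∈-++⁺ʳ (consec (o ∷ y ∷ ys))
                  (here (cong (o ,_) (sym (trans (cong (lastOf o) (sym eq)) (lastOf-rest F)))))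

within-inner : ∀ {o e V} (F : Forest o e) → Proper F → V ∈ inner F → Within o e V
within-inner F p i v with inner-span F p i
... | _ , d , s with edge-bounds F p d
... | a , _ , b = ≤-trans a (proj₁ (s v)) , ≤-trans (proj₂ (s v)) b

within-cells : ∀ {o e V} (F : Forest o e) → Proper F → V ∈ cells F → Within o e V
within-cells F p (here refl) = verts-within F p
within-cells F p (there i) = within-inner F p i

cells-sound : ∀ {o e V} (F : Forest o e) → Proper F → Wide F → V ∈ cells F → CellFor (EdgeOrBase F) V
inner-sound : ∀ {o e V} (F : Forest o e) → Proper F → V ∈ inner F → CellFor (Edge F) V

cells-sound F p wd (here refl) = wide-cell F p wd
cells-sound {o} {e} {V} F p wd (there i) = CellFor-cong h (inner-sound F p i)
  where
  no-base : o ∈ V → e ∈ V → ⊥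
  no-base oi ei with inner-span F p i
  ... | (x , y) , d , s with edge-bounds F p d
  ... | a , b , c with refl ← ≤-antisym (proj₁ (s oi)) a | refl ← ≤-antisym c (proj₂ (s ei)) =
    base-not-edge F p wd d
  h : ∀ {u w} → u ∈ V → w ∈ V → u < w → Edge F u w ⇔ EdgeOrBase F u w
  h {u} {w} ui wi u<w = mk⇔ inj₁ g
    where
    g : EdgeOrBase F u w → Edge F u w
    g (inj₁ x) = x
    g (inj₂ (refl , refl)) = ⊥-elim (no-base ui wi)

inner-sound (side F) p i =
  CellFor-cong (λ ui _ _ → side-local F (proj₁ (within-inner F p i ui))) (inner-sound F p i)
inner-sound (sub G F) p@(wd , pG , pF) i with ∈-++⁻ (cells G) i
... | inj₁ j = CellFor-cong (λ _ wi u<w → sub-local-in G F p (proj₂ (within-cells G pG j wi)) u<w)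
                 (cells-sound G pG wd j)
... | inj₂ j = CellFor-cong (λ ui _ _ → sub-local-there G F p (proj₁ (within-inner F pF j ui)))
                 (inner-sound F pF j)

-- The list and the path of `F` are followed in parallel. That steps of the list are edges does not
-- suffice, since a detour below a chord also consists of edges; the last hypothesis rules it out.
verts-unique : ∀ {o e} (F : Forest o e) → Proper F → ∀ ws → Increasing (o ∷ ws) → lastOf o ws ≡ e →
  (∀ {u w} → (u , w) ∈ consec (o ∷ ws) → Edge F u w) →
  (∀ {u w} → u ∈ o ∷ ws → w ∈ o ∷ ws → Edge F u w → (u , w) ∈ consec (o ∷ ws)) →
  ws ≡ rest F
verts-unique nil p [] inc l c d = refl
verts-unique nil p (v ∷ vs) ((a ∷ _) ∷ inc) l c d =
  contradiction (≤-trans a (≤-trans (last-greatest inc (here refl)) (≤-reflexive l))) (<-irrefl refl)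
verts-unique (side F) p [] inc refl c d = contradiction (ends-≤ F p) (<-irrefl refl)
verts-unique (side F) p (v ∷ vs) inc l c d with c (here refl)
verts-unique (side F) p (v ∷ vs) inc l c d | side-there x =
  contradiction (proj₁ (edge-bounds F p x)) (<-irrefl refl)
verts-unique (side {o} F) p (v ∷ vs) (_ ∷ inc) l c d | side-here =
  cong (suc o ∷_) (verts-unique F p vs inc l c′ d′)
  where
  c′ : ∀ {u w} → (u , w) ∈ consec (suc o ∷ vs) → Edge F u w
  c′ i = from (side-local F (head-least inc (proj₁ (consec-∈ _ i)))) (c (there i))
  d′ : ∀ {u w} → u ∈ suc o ∷ vs → w ∈ suc o ∷ vs → Edge F u w → (u , w) ∈ consec (suc o ∷ vs)
  d′ ui wi x with d (there ui) (there wi) (side-there x)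
  ... | here refl = contradiction (head-least inc ui) (<-irrefl refl)
  ... | there i = i
verts-unique (sub G F) (wd , pG , pF) [] inc refl c d =
  contradiction (≤-trans (<⇒≤ (wide-< G pG wd)) (ends-≤ F pF)) (<-irrefl refl)
verts-unique (sub G F) (wd , pG , pF) (v ∷ vs) inc l c d with c (here refl)
verts-unique (sub G F) (wd , pG , pF) (v ∷ vs) inc l c d | sub-there x =
  contradiction (≤-trans (<⇒≤ (wide-< G pG wd)) (proj₁ (edge-bounds F pF x))) (<-irrefl refl)
verts-unique (sub {o} {b} G F) p@(wd , pG , pF) (v ∷ vs) (_ ∷ inc) l c d | sub-here =
  cong (b ∷_) (verts-unique F pF vs inc l c′ d′)
  where
  c′ : ∀ {u w} → (u , w) ∈ consec (b ∷ vs) → Edge F u w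
  c′ i = from (sub-local-there G F p (head-least inc (proj₁ (consec-∈ _ i)))) (c (there i))
  d′ : ∀ {u w} → u ∈ b ∷ vs → w ∈ b ∷ vs → Edge F u w → (u , w) ∈ consec (b ∷ vs)
  d′ ui wi x with d (there ui) (there wi) (sub-there x)
  ... | here refl = contradiction (≤-trans (<⇒≤ (wide-< G pG wd)) (head-least inc ui)) (<-irrefl refl)
  ... | there i = i
-- A path that enters the part below (o , b) can only leave it through b, but then (o , b) is a shortcut.
verts-unique (sub {o} {b} {e} G F) p@(wd , pG , pF) (v ∷ vs) ((o<v ∷ _) ∷ inc) l c d | sub-in x =
  ⊥-elim (shortcut (d (here refl) (there (exit v vs o<v v<b l (λ i → c (there i)) inc)) sub-here))
  where
  v<b : v < b
  v<b = ≤∧≢⇒< (proj₂ (proj₂ (edge-bounds G pG x))) λ { refl → base-not-edge G pG wd x }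
  exit : ∀ y ys → o < y → y < b → lastOf y ys ≡ e →
         (∀ {u w} → (u , w) ∈ consec (y ∷ ys) → Edge (sub G F) u w) → Increasing (y ∷ ys) → b ∈ y ∷ ys
  exit y [] o<y y<b refl c inc = contradiction (≤-trans y<b (ends-≤ F pF)) (<-irrefl refl)
  exit y (z ∷ zs) o<y y<b l c inc@((y<z ∷ _) ∷ inc′) with c (here refl)
  ... | sub-here = contradiction o<y (<-irrefl refl)
  ... | sub-there t = contradiction (≤-trans y<b (proj₁ (edge-bounds F pF t))) (<-irrefl refl)
  ... | sub-in t with m≤n⇒m<n∨m≡n (proj₂ (proj₂ (edge-bounds G pG t)))
  ... | inj₂ refl = there (here refl)
  ... | inj₁ z<b = there (exit z zs (<-trans o<y y<z) z<b l (λ i → c (there i)) inc′)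
  shortcut : (o , b) ∈ consec (o ∷ v ∷ vs) → ⊥
  shortcut (here refl) = <-irrefl refl v<b
  shortcut (there i) = <-irrefl refl (≤-trans o<v (head-least inc (proj₁ (consec-∈ _ i))))

-- The least and the greatest vertex form a pair of `cycPairs`, so they are joined. If they are
-- joined by the base, the list is the outermost path; if by an edge, the list is an inner cell.
cells-complete : ∀ {o e V} (F : Forest o e) → Proper F → Wide F → CellFor (EdgeOrBase F) V → V ∈ cells F
inner-complete : ∀ {o e V} (F : Forest o e) → Proper F → CellFor (Edge F) V → V ∈ inner F

cells-complete {o} {e} {x ∷ y ∷ z ∷ zs} F p wd (inc@((x<y ∷ x<z ∷ _) ∷ inc″@((y<z ∷ _) ∷ inc′)) , len , bd)
  with to (bd (here refl) (lastOf-∈ x (y ∷ z ∷ zs)) x<l) (∈-++⁺ʳ (consec (x ∷ y ∷ z ∷ zs)) (here refl))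
  where
  x<l : x < lastOf z zs
  x<l = ≤-trans x<z (last-greatest inc′ (here refl))
... | inj₁ d = there (inner-complete F p (CellFor-cong h (inc , len , bd)))
  where
  h : ∀ {u w} → u ∈ x ∷ y ∷ z ∷ zs → w ∈ x ∷ y ∷ z ∷ zs → u < w → EdgeOrBase F u w ⇔ Edge F u w
  h ui wi u<w = mk⇔ g inj₁
    where
    g : EdgeOrBase F _ _ → Edge F _ _
    g (inj₁ k) = k
    g (inj₂ (refl , refl)) with edge-bounds F p d
    ... | a , b , c with refl ← ≤-antisym (head-least inc ui) a
                       | refl ← ≤-antisym c (last-greatest inc wi) = d
... | inj₂ (refl , eq) = here (cong (x ∷_) (verts-unique F p (y ∷ z ∷ zs) inc eq c d))
  where
  y<e : y < e
  y<e = ≤-trans y<z (≤-trans (last-greatest inc′ (here refl)) (≤-reflexive eq))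
  not-base : (x , e) ∈ consec (x ∷ y ∷ z ∷ zs) → ⊥
  not-base (here refl) = <-irrefl refl y<e
  not-base (there i) = <-irrefl refl (≤-trans x<y (head-least inc″ (proj₁ (consec-∈ _ i))))
  c : ∀ {u w} → (u , w) ∈ consec (x ∷ y ∷ z ∷ zs) → Edge F u w
  c i with consec-∈ (x ∷ y ∷ z ∷ zs) i
  ... | ui , wi with to (bd ui wi (consec-< inc i)) (∈-++⁺ˡ i)
  ... | inj₁ k = k
  ... | inj₂ (refl , refl) = ⊥-elim (not-base i)
  d : ∀ {u w} → u ∈ x ∷ y ∷ z ∷ zs → w ∈ x ∷ y ∷ z ∷ zs → Edge F u w → (u , w) ∈ consec (x ∷ y ∷ z ∷ zs)
  d {u} {w} ui wi k with ∈-++⁻ (consec (x ∷ y ∷ z ∷ zs)) (from (bd ui wi (proj₁ (proj₂ (edge-bounds F p k)))) (inj₁ k))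
  ... | inj₁ i = i
  ... | inj₂ (here refl) = ⊥-elim (base-not-edge F p wd (subst (Edge F x) eq k))
cells-complete {V = []} F p wd (_ , () , _)
cells-complete {V = x ∷ []} F p wd (_ , s≤s () , _)
cells-complete {V = x ∷ y ∷ []} F p wd (_ , s≤s (s≤s ()) , _)

inner-complete {V = []} F p (_ , () , _)
inner-complete {V = x ∷ []} F p (_ , s≤s () , _)
inner-complete {V = x ∷ y ∷ []} F p (_ , s≤s (s≤s ()) , _)
inner-complete {V = x ∷ y ∷ z ∷ zs} F p cell@(inc@((x<y ∷ x<z ∷ _) ∷ (y<z ∷ _) ∷ inc′) , len , bd) = go F p cell d
  where
  x<l : x < lastOf z zs
  x<l = ≤-trans x<z (last-greatest inc′ (here refl))
  d : Edge F x (lastOf z zs)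
  d = to (bd (here refl) (lastOf-∈ x (y ∷ z ∷ zs)) x<l) (∈-++⁺ʳ (consec (x ∷ y ∷ z ∷ zs)) (here refl))
  -- The closing edge serves as an address: it is followed down the forest until it is the base of a
  -- part or lies inside one.
  go : ∀ {o e} (F : Forest o e) → Proper F → CellFor (Edge F) (x ∷ y ∷ z ∷ zs) →
       Edge F x (lastOf z zs) → x ∷ y ∷ z ∷ zs ∈ inner F
  go (side F) p cell k = sideCase k refl
    where
    sideCase : ∀ {u w} → Edge (side F) u w → (u , w) ≡ (x , lastOf z zs) → x ∷ y ∷ z ∷ zs ∈ inner (side F)
    -- A side cannot close a cell, since it leaves no room for the middle vertex `y`.
    sideCase side-here eq with refl ← cong proj₁ eq =
      contradiction (≤-trans (s≤s x<y) (≤-trans y<z (≤-trans (last-greatest inc′ (here refl)) (≤-reflexive (sym (cong proj₂ eq)))))) (<-irrefl refl)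
    sideCase (side-there k) refl = go F p
      (CellFor-cong (λ ui _ _ → ⇔-sym (side-local F (≤-trans (proj₁ (edge-bounds F p k)) (head-least inc ui)))) cell) k
  go (sub {b = b} G F) p@(wd , pG , pF) cell k = subCase k refl
    where
    below : lastOf z zs ≤ b → x ∷ y ∷ z ∷ zs ∈ inner (sub G F)
    below l≤b = ∈-++⁺ˡ (cells-complete G pG wd
      (CellFor-cong (λ _ wi u<w → ⇔-sym (sub-local-in G F p (≤-trans (last-greatest inc wi) l≤b) u<w)) cell))
    subCase : ∀ {u w} → Edge (sub G F) u w → (u , w) ≡ (x , lastOf z zs) → x ∷ y ∷ z ∷ zs ∈ inner (sub G F)
    subCase sub-here eq = below (≤-reflexive (sym (cong proj₂ eq)))
    subCase (sub-in k) refl = below (proj₂ (proj₂ (edge-bounds G pG k)))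
    subCase (sub-there k) refl = ∈-++⁺ʳ (cells G) (go F pF
      (CellFor-cong (λ ui _ _ → ⇔-sym (sub-local-there G F p (≤-trans (proj₁ (edge-bounds F pF k)) (head-least inc ui)))) cell) k)

-- From a dissection to its forest

Uncrossed : (ℕ → ℕ → Set) → Set
Uncrossed R = ∀ {a b c d} → R a b → R c d → a < c → c < b → b < d → ⊥

-- The bound `b` restricts only the edges leaving `o`. Lowering it is the search for the first step
-- of the path, and a bound below `e` keeps the base out.
InRange : (o e b u w : ℕ) → Set
InRange o e b u w = o ≤ u × u < w × w ≤ e × (u ≡ o → w ≤ b)

record Built (R : ℕ → ℕ → Set) (o e b : ℕ) : Set where
  field
    forest  : Forest o e
    proper  : Proper forest
    sound   : ∀ {u w} → Edge forest u w → R u w × InRange o e b u w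
    complete : ∀ {u w} → R u w → InRange o e b u w → Edge forest u w

widen : ∀ {o e} (F : Forest o e) → suc o < e → ¬ Edge F o e → Wide F
widen nil lt _ = contradiction (<-trans (n<1+n _) lt) (<-irrefl refl)
widen (side nil) lt _ = contradiction lt (<-irrefl refl)
widen (side (side _)) _ _ = s≤s (s≤s z≤n)
widen (side (sub _ _)) _ _ = s≤s (s≤s z≤n)
widen (sub _ nil) _ nb = contradiction sub-here nb
widen (sub _ (side _)) _ _ = s≤s (s≤s z≤n)
widen (sub _ (sub _ _)) _ _ = s≤s (s≤s z≤n)

module _ {R : ℕ → ℕ → Set} where

  nil-built : ∀ {o} → Built R o o o
  nil-built = record
    { forest = nil ; proper = tt ; sound = λ ()
    ; complete = λ { _ (a , b , c , _) → contradiction (≤-trans b (≤-trans c a)) (<-irrefl refl) } }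

  side-built : ∀ {o e} → o < e → R o (suc o) → Built R (suc o) e e → Built R o e (suc o)
  side-built {o} {e} o<e r₀ B = record
    { forest = side F.forest ; proper = F.proper ; sound = snd ; complete = cmp }
    where
    module F = Built B
    snd : ∀ {u w} → Edge (side F.forest) u w → R u w × InRange o e (suc o) u w
    snd side-here = r₀ , ≤-refl , ≤-refl , o<e , λ _ → ≤-refl
    snd (side-there x) with F.sound x
    ... | r , a , b , c , _ = r , <⇒≤ a , b , c , λ { refl → contradiction a (<-irrefl refl) }
    cmp : ∀ {u w} → R u w → InRange o e (suc o) u w → Edge (side F.forest) u w
    cmp r (a , b , c , d) with m≤n⇒m<n∨m≡n a
    ... | inj₁ o<u = side-there (F.complete r (o<u , b , c , λ _ → c))
    ... | inj₂ refl with refl ← ≤-antisym (d refl) b = side-here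

  skip-built : ∀ {o e b} → ¬ R o (suc b) → Built R o e b → Built R o e (suc b)
  skip-built ¬r B = record
    { forest = G.forest ; proper = G.proper
    ; sound = λ x → let r , a , b , c , d = G.sound x in r , a , b , c , λ eq → m≤n⇒m≤1+n (d eq)
    ; complete = λ { r (a , b , c , d) → G.complete r (a , b , c , λ { refl →
        ≤-pred (≤∧≢⇒< (d refl) λ { refl → ¬r r }) }) } }
    where
    module G = Built B

  sub-built : Uncrossed R → ∀ {o e b} → o < b → suc b ≤ e → R o (suc b) →
              Built R o (suc b) b → Built R (suc b) e e → Built R o e (suc b)
  sub-built uncrossed {o} {e} {b′} o<b′ b≤e r₀ B C = record
    { forest = sub G.forest F.forest ; proper = wide , G.proper , F.proper ; sound = snd ; complete = cmp }
    where
    b = suc b′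
    o<b : o < b
    o<b = m≤n⇒m≤1+n o<b′
    module G = Built B
    module F = Built C
    -- The part below the chord was built with the bound `b′`, one less than `b`, so its base is not
    -- among its edges.
    wide : Wide G.forest
    wide = widen G.forest (s≤s o<b′)
      λ x → <-irrefl refl (proj₂ (proj₂ (proj₂ (proj₂ (G.sound x)))) refl)
    snd : ∀ {u w} → Edge (sub G.forest F.forest) u w → R u w × InRange o e b u w
    snd sub-here = r₀ , ≤-refl , o<b , b≤e , λ _ → ≤-refl
    snd (sub-in x) with G.sound x
    ... | r , p , q , s , _ = r , p , q , ≤-trans s b≤e , λ _ → s
    snd (sub-there x) with F.sound x
    ... | r , p , q , s , _ = r , ≤-trans (<⇒≤ o<b) p , q , s ,
          λ { refl → contradiction (≤-trans o<b p) (<-irrefl refl) }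
    cmp : ∀ {u w} → R u w → InRange o e b u w → Edge (sub G.forest F.forest) u w
    cmp {u} {w} r (p , q , s , t) with m≤n⇒m<n∨m≡n p
    ... | inj₂ refl with m≤n⇒m<n∨m≡n (t refl)
    ... | inj₂ refl = sub-here
    ... | inj₁ w<b = sub-in (G.complete r (≤-refl , q , <⇒≤ w<b , λ _ → ≤-pred w<b))
    cmp {u} {w} r (p , q , s , t) | inj₁ o<u with b ≤? u
    ... | yes b≤u = sub-there (F.complete r (b≤u , q , s , λ _ → s))
    ... | no b≰u with w ≤? b
    ... | yes w≤b = sub-in (G.complete r (p , q , w≤b , λ { refl → contradiction o<u (<-irrefl refl) }))
    ... | no w≰b = ⊥-elim (uncrossed r₀ r o<u (≰⇒> b≰u) (≰⇒> w≰b))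

  step-built : Uncrossed R → ∀ {o e b} → Dec (R o (suc b)) → o < b → suc b ≤ e →
               Built R o e b → Built R o (suc b) b → Built R (suc b) e e → Built R o e (suc b)
  step-built uncrossed (no ¬r) o<b b<e A B C = skip-built ¬r A
  step-built uncrossed (yes r) o<b b<e A B C = sub-built uncrossed o<b b<e r B C

module _ {R : ℕ → ℕ → Set} (R? : ∀ u w → Dec (R u w)) (uncrossed : Uncrossed R)
         (sides : ∀ u → R u (suc u)) where

  -- The first step from o follows the longest edge not longer than (o , k + suc o).
  build : ∀ m k {o e} → e ∸ o ≤ m → k + suc o ≤ e → Built R o e (k + suc o)
  buildAll : ∀ m {o e} → e ∸ o ≤ m → o ≤ e → Built R o e e

  buildAll m {o} {e} len o≤e with m≤n⇒m<n∨m≡n o≤e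
  ... | inj₂ refl = nil-built
  ... | inj₁ o<e =
    subst (Built R o e) (m∸n+n≡m o<e) (build m (e ∸ suc o) len (≤-reflexive (m∸n+n≡m o<e)))

  build zero k {o} {e} len k<e =
    contradiction (≤-trans (m≤n+m (suc o) k) (≤-trans k<e (m∸n≡0⇒m≤n (n≤0⇒n≡0 len)))) (<-irrefl refl)
  build (suc m) zero {o} {e} len o<e =
    side-built o<e (sides o)
      (buildAll m (subst (_≤ m) (pred[m∸n]≡m∸[1+n] e o) (pred-mono-≤ len)) o<e)
  build (suc m) (suc k) {o} {e} len b≤e =
    step-built uncrossed (R? o (suc k + suc o)) (m≤n+m (suc o) k) b≤e
      (build (suc m) k len (<⇒≤ b≤e))
      (build (suc m) k (≤-trans (∸-monoˡ-≤ o b≤e) len) (n≤1+n _))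
      (buildAll m (≤-trans (∸-monoʳ-≤ e (m≤n+m (suc o) (suc k)))
        (subst (_≤ m) (pred[m∸n]≡m∸[1+n] e o) (pred-mono-≤ len))) b≤e)

AllPairs-lookup : ∀ {A : Set} {R : A → A → Set} {xs : List A} → AllPairs R xs → ∀ {x y} →
                  x ∈ xs → y ∈ xs → x ≡ y ⊎ R x y ⊎ R y x
AllPairs-lookup (a ∷ as) (here refl) (here refl) = inj₁ refl
AllPairs-lookup (a ∷ as) (here refl) (there j) = inj₂ (inj₁ (All.lookup a j))
AllPairs-lookup (a ∷ as) (there i) (here refl) = inj₂ (inj₂ (All.lookup a i))
AllPairs-lookup (a ∷ as) (there i) (there j) = AllPairs-lookup as i j

SideOrChord : ∀ {N} → Dissection N → ℕ → ℕ → Set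
SideOrChord {N} D u w = IsSide N (u , w) ⊎ (u , w) ∈ chords D

Represents : ∀ {e} → Forest 0 e → Dissection (suc e) → Set
Represents {e} F D = ∀ {u w} → u < w → w ≤ e → EdgeOrBase F u w ⇔ SideOrChord D u w

dissection⇒forest : ∀ {e} → 1 < e → (D : Dissection (suc e)) →
                    Σ (Forest 0 e) λ F → Proper F × Wide F × Represents F D
dissection⇒forest {suc (suc k)} _ D = B.forest , B.proper , wide , rep
  where
  e = suc (suc k)
  -- The root side from 0 to `e` is left out on purpose: it comes back as the base of the forest.
  R : ℕ → ℕ → Set
  R u w = suc u ≡ w ⊎ (u , w) ∈ chords D
  R? : ∀ u w → Dec (R u w)
  R? u w with suc u ≟ w | (u , w) ∈? chords D
  ... | yes p | _ = yes (inj₁ p)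
  ... | no _  | yes q = yes (inj₂ q)
  ... | no ¬p | no ¬q = no λ { (inj₁ p) → ¬p p ; (inj₂ q) → ¬q q }
  uncrossed : Uncrossed R
  uncrossed (inj₁ refl) _ a<c c<b _ = <-irrefl refl (≤-trans a<c (≤-pred c<b))
  uncrossed (inj₂ _) (inj₁ refl) _ c<b b<d = <-irrefl refl (≤-trans c<b (≤-pred b<d))
  uncrossed (inj₂ p) (inj₂ q) a<c c<b b<d with AllPairs-lookup (noncrossing D) p q
  ... | inj₁ refl = <-irrefl refl a<c
  ... | inj₂ (inj₁ ¬x) = ¬x (inj₁ (a<c , c<b , b<d))
  ... | inj₂ (inj₂ ¬x) = ¬x (inj₂ (a<c , c<b , b<d))
  -- The initial bound `k + 1` is `e - 1`, so that the first step cannot be the root side and the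
  -- forest is wide.
  module B = Built (build R? uncrossed (λ _ → inj₁ refl) e k {0} {e} ≤-refl
               (≤-trans (≤-reflexive (+-comm k 1)) (n≤1+n _)))
  k+1<e : k + 1 < e
  k+1<e = s≤s (≤-reflexive (+-comm k 1))
  wide : Wide B.forest
  wide = widen B.forest (s≤s (s≤s z≤n)) λ x →
    <-irrefl refl (≤-trans k+1<e (proj₂ (proj₂ (proj₂ (proj₂ (B.sound x)))) refl))
  rep : Represents B.forest D
  rep {u} {w} u<w w≤e = mk⇔ f g
    where
    f : EdgeOrBase B.forest u w → SideOrChord D u w
    f (inj₁ x) with proj₁ (B.sound x)
    ... | inj₁ p = inj₁ (inj₁ p)
    ... | inj₂ q = inj₂ q
    f (inj₂ (refl , refl)) = inj₁ (inj₂ (refl , refl))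
    h : R u w → EdgeOrBase B.forest u w
    h r with u ≟ 0 | w ≟ e
    ... | yes p | yes q = inj₂ (p , q)
    ... | no p  | _     = inj₁ (B.complete r (z≤n , u<w , w≤e , λ u≡0 → contradiction u≡0 p))
    ... | yes _ | no q  = inj₁ (B.complete r (z≤n , u<w , w≤e , λ _ →
            subst (w ≤_) (+-comm 1 k) (≤-pred (≤∧≢⇒< w≤e q))))
    g : SideOrChord D u w → EdgeOrBase B.forest u w
    g (inj₁ (inj₁ p)) = h (inj₁ p)
    g (inj₁ (inj₂ (p , q))) = inj₂ (p , suc-injective q)
    g (inj₂ q) = h (inj₂ q)
dissection⇒forest {1} (s≤s ()) D

-- From a forest to its dissection

chord⇒edge : ∀ {o e u w} (F : Forest o e) → (u , w) ∈ chordsOf F → Edge F u w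
chord⇒edge (side F) i = side-there (chord⇒edge F i)
chord⇒edge (sub G F) (here refl) = sub-here
chord⇒edge (sub G F) (there i) with ∈-++⁻ (chordsOf G) i
... | inj₁ j = sub-in (chord⇒edge G j)
... | inj₂ j = sub-there (chord⇒edge F j)

chord-long : ∀ {o e u w} (F : Forest o e) → Proper F → (u , w) ∈ chordsOf F → suc u < w
chord-long (side F) p i = chord-long F p i
chord-long (sub G F) (wd , pG , pF) (here refl) = wide-< G pG wd
chord-long (sub G F) (wd , pG , pF) (there i) with ∈-++⁻ (chordsOf G) i
... | inj₁ j = chord-long G pG j
... | inj₂ j = chord-long F pF j

edge⇒side⊎chord : ∀ {o e u w} (F : Forest o e) → Edge F u w → suc u ≡ w ⊎ (u , w) ∈ chordsOf F
edge⇒side⊎chord (side F) side-here = inj₁ refl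
edge⇒side⊎chord (side F) (side-there x) = edge⇒side⊎chord F x
edge⇒side⊎chord (sub G F) sub-here = inj₂ (here refl)
edge⇒side⊎chord (sub G F) (sub-in x) with edge⇒side⊎chord G x
... | inj₁ p = inj₁ p
... | inj₂ i = inj₂ (there (∈-++⁺ˡ i))
edge⇒side⊎chord (sub G F) (sub-there x) with edge⇒side⊎chord F x
... | inj₁ p = inj₁ p
... | inj₂ i = inj₂ (there (∈-++⁺ʳ (chordsOf G) i))

side-edge : ∀ {o e u} (F : Forest o e) → o ≤ u → u < e → Edge F u (suc u)
side-edge nil o≤u u<e = contradiction (≤-trans u<e o≤u) (<-irrefl refl)
side-edge (side F) o≤u u<e with m≤n⇒m<n∨m≡n o≤u
... | inj₁ o<u = side-there (side-edge F o<u u<e)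
... | inj₂ refl = side-here
side-edge {u = u} (sub {b = b} G F) o≤u u<e with b ≤? u
... | yes b≤u = sub-there (side-edge F b≤u u<e)
... | no b≰u = sub-in (side-edge G o≤u (≰⇒> b≰u))

Apart : Chord → Chord → Set
Apart c d = c ≢ d × ¬ Cross c d

chordsOf-apart : ∀ {o e} (F : Forest o e) → Proper F → AllPairs Apart (chordsOf F)
chordsOf-apart nil p = []
chordsOf-apart (side F) p = chordsOf-apart F p
chordsOf-apart (sub {o} {b} G F) (wd , pG , pF) =
  All.tabulate first ∷ AllPairsₚ.++⁺ (chordsOf-apart G pG) (chordsOf-apart F pF)
    (All.tabulate λ i → All.tabulate λ j → split i j)
  where
  first : ∀ {d} → d ∈ chordsOf G ++ chordsOf F → Apart (o , b) d
  first {u , w} i with ∈-++⁻ (chordsOf G) i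
  ... | inj₁ j with chord⇒edge G j
  ... | x with edge-bounds G pG x
  ... | l , m , r = (λ { refl → base-not-edge G pG wd x }) ,
        λ { (inj₁ (_ , _ , q)) → <-irrefl refl (≤-trans q r)
          ; (inj₂ (q , _ , _)) → <-irrefl refl (≤-trans q l) }
  first {u , w} i | inj₂ j with chord⇒edge F j
  ... | x with edge-bounds F pF x
  ... | l , m , r = (λ { refl → <-irrefl refl (≤-trans (<⇒≤ (wide-< G pG wd)) l) }) ,
        λ { (inj₁ (_ , q , _)) → <-irrefl refl (≤-trans q l)
          ; (inj₂ (q , _ , _)) → <-irrefl refl (≤-trans q (≤-trans (ends-≤ G pG) l)) }
  split : ∀ {c d} → c ∈ chordsOf G → d ∈ chordsOf F → Apart c d
  split {u , w} {u′ , w′} i j with edge-bounds G pG (chord⇒edge G i) | edge-bounds F pF (chord⇒edge F j)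
  ... | _ , m , r | l , m′ , _ = (λ { refl → <-irrefl refl (≤-trans m (≤-trans r l)) }) ,
        λ { (inj₁ (_ , q , _)) → <-irrefl refl (≤-trans q (≤-trans r l))
          ; (inj₂ (q , s , _)) → <-irrefl refl (≤-trans q (≤-trans (<⇒≤ m) (≤-trans r l))) }

forest⇒dissection : ∀ {e} (F : Forest 0 e) → Proper F → Wide F → Σ (Dissection (suc e)) (Represents F)
forest⇒dissection {e} F p wd = D , rep
  where
  diag : ∀ {c} → c ∈ chordsOf F → IsDiagonal (suc e) c
  diag {u , w} i with edge-bounds F p (chord⇒edge F i)
  ... | _ , m , r = m , s≤s r ,
        λ { (inj₁ refl) → <-irrefl refl (chord-long F p i)
          ; (inj₂ (refl , q)) → base-not-edge F p wd
              (subst (Edge F 0) (suc-injective q) (chord⇒edge F i)) }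
  D : Dissection (suc e)
  D = record
    { chords = chordsOf F
    ; diagonals = All.tabulate diag
    ; distinct = AllPairs.map proj₁ (chordsOf-apart F p)
    ; noncrossing = AllPairs.map proj₂ (chordsOf-apart F p) }
  rep : Represents F D
  rep {u} {w} u<w w≤e = mk⇔ f g
    where
    f : EdgeOrBase F u w → SideOrChord D u w
    f (inj₁ x) with edge⇒side⊎chord F x
    ... | inj₁ q = inj₁ (inj₁ q)
    ... | inj₂ i = inj₂ i
    f (inj₂ (refl , refl)) = inj₁ (inj₂ (refl , refl))
    g : SideOrChord D u w → EdgeOrBase F u w
    g (inj₁ (inj₁ refl)) = inj₁ (side-edge F z≤n w≤e)
    g (inj₁ (inj₂ (q , r))) = inj₂ (q , suc-injective r)
    g (inj₂ i) = inj₁ (chord⇒edge F i)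

-- Quiddities as words

data Letter : Set where
  T S : Letter

Word : Set
Word = List Letter

word : ∀ {o e} → Forest o e → Word
word nil       = T ∷ []
word (side F)  = T ∷ S ∷ word F
word (sub G F) = T ∷ word G ++ word F

δ : ℕ → ℕ → ℕ
δ o x = if does (o ≟ x) then 1 else 0

δ-refl : ∀ x → δ x x ≡ 1
δ-refl x rewrite dec-true (x ≟ x) refl = refl

δ-≢ : ∀ o x → o ≢ x → δ o x ≡ 0
δ-≢ o x o≢x rewrite dec-false (o ≟ x) o≢x = refl

-- The x-th entry of the tuple T^{a_o} S T^{a_{o+1}} S ⋯ encoded by a word.
cnt : ℕ → Word → ℕ → ℕ
cnt o []      x = 0
cnt o (T ∷ w) x = δ o x + cnt o w x
cnt o (S ∷ w) x = cnt (suc o) w x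

-- A word contains one `S` for each side of its path, so after `word F` the vertex being read is
-- `e`.
cnt-++ : ∀ {o e} (F : Forest o e) v x → cnt o (word F ++ v) x ≡ cnt o (word F) x + cnt e v x
cnt-++ {o} nil v x = cong (_+ cnt o v x) (sym (+-identityʳ (δ o x)))
cnt-++ {o} (side F) v x = trans (cong (δ o x +_) (cnt-++ F v x)) (sym (+-assoc (δ o x) _ _))
cnt-++ {o} (sub {b = b} {e = e} G F) v x = begin
  δ o x + cnt o ((word G ++ word F) ++ v) x       ≡⟨ cong (λ w → δ o x + cnt o w x) (++-assoc (word G) (word F) v) ⟩
  δ o x + cnt o (word G ++ word F ++ v) x         ≡⟨ cong (δ o x +_) (cnt-++ G (word F ++ v) x) ⟩
  δ o x + (cnt o (word G) x + cnt b (word F ++ v) x) ≡⟨ cong (λ t → δ o x + (cnt o (word G) x + t)) (cnt-++ F v x) ⟩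
  δ o x + (cnt o (word G) x + (cnt b (word F) x + cnt e v x)) ≡⟨ cong (δ o x +_) (+-assoc (cnt o (word G) x) _ _) ⟨
  δ o x + (cnt o (word G) x + cnt b (word F) x + cnt e v x) ≡⟨ +-assoc (δ o x) _ _ ⟨
  δ o x + (cnt o (word G) x + cnt b (word F) x) + cnt e v x ≡⟨ cong (λ t → δ o x + t + cnt e v x) (cnt-++ G (word F) x) ⟨
  δ o x + cnt o (word G ++ word F) x + cnt e v x  ∎
  where
  open ≡-Reasoning

occ : ℕ → List ℕ → ℕ
occ x []       = 0
occ x (y ∷ ys) = δ y x + occ x ys

occ-∉ : ∀ {x} V → x ∉ V → occ x V ≡ 0
occ-∉ [] _ = refl
occ-∉ {x} (y ∷ ys) x∉ = cong₂ _+_ (δ-≢ y x λ { refl → x∉ (here refl) }) (occ-∉ ys λ i → x∉ (there i))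

occ-∈ : ∀ {x V} → Increasing V → x ∈ V → occ x V ≡ 1
occ-∈ {x} {_ ∷ ys} (a ∷ inc) (here refl) =
  cong₂ _+_ (δ-refl x) (occ-∉ ys λ i → <-irrefl refl (All.lookup a i))
occ-∈ {x} {y ∷ _} (a ∷ inc) (there i) = cong₂ _+_ (δ-≢ y x λ { refl → <-irrefl refl (All.lookup a i) }) (occ-∈ inc i)

length-filter-∈ : ∀ x {Vs} → All Increasing Vs → length (filter (x ∈ℕ?_) Vs) ≡ sum (map (occ x) Vs)
length-filter-∈ x [] = refl
length-filter-∈ x {V ∷ Vs} (i ∷ is) with x ∈ℕ? V
... | yes p = cong₂ _+_ (sym (occ-∈ i p)) (length-filter-∈ x is)
... | no ¬p = cong₂ _+_ (sym (occ-∉ V ¬p)) (length-filter-∈ x is)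

-- Letters `T` correspond to pairs of a cell and one of its vertices. In `T ∷ word G ++ word F` the
-- first `T` is the vertex `o` of the outer cell, and `word G` carries the cells below the chord.
cnt-word : ∀ {o e} (F : Forest o e) x → cnt o (word F) x ≡ sum (map (occ x) (cells F))
cnt-word {o} nil x = sym (+-identityʳ (δ o x + 0))
cnt-word {o} (side F) x = trans (cong (δ o x +_) (cnt-word F x)) (sym (+-assoc (δ o x) _ _))
cnt-word {o} (sub {b = b} G F) x = begin
  δ o x + cnt o (word G ++ word F) x                 ≡⟨ cong (δ o x +_) (cnt-++ G (word F) x) ⟩
  δ o x + (cnt o (word G) x + cnt b (word F) x)      ≡⟨ cong₂ (λ s t → δ o x + (s + t)) (cnt-word G x) (cnt-word F x) ⟩
  δ o x + (sum (map (occ x) (cells G)) + (occ x (verts F) + sum (map (occ x) (inner F)))) ≡⟨ shuffle (δ o x) (sum (map (occ x) (cells G))) (occ x (verts F)) _ ⟩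
  δ o x + occ x (verts F) + (sum (map (occ x) (cells G)) + sum (map (occ x) (inner F)))
    ≡⟨ cong (δ o x + occ x (verts F) +_) (trans (cong sum (map-++ (occ x) (cells G) (inner F))) (sum-++ (map (occ x) (cells G)) _)) ⟨
  δ o x + occ x (verts F) + sum (map (occ x) (cells G ++ inner F)) ∎
  where
  open ≡-Reasoning
  shuffle : ∀ a b c d → a + (b + (c + d)) ≡ a + c + (b + d)
  shuffle = solve-∀

ends : List ℕ → Chord
ends []       = 0 , 0
ends (x ∷ xs) = x , lastOf x xs

ends-inner : ∀ {o e} (F : Forest o e) → map ends (inner F) ≡ chordsOf F
ends-inner nil = refl
ends-inner (side F) = ends-inner F
ends-inner (sub {o} G F) = cong₂ _∷_ (cong (o ,_) (lastOf-rest G))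
  (trans (map-++ ends (inner G) (inner F)) (cong₂ _++_ (ends-inner G) (ends-inner F)))

-- Cells are told apart by their least and greatest vertices: for inner cells these are the pairwise
-- distinct chords, for the outermost cell the base.
cells-unique : ∀ {o e} (F : Forest o e) → Proper F → Wide F → Unique (cells F)
cells-unique {o} {e} F p wd =
  Uniqueₚ.map⁻ uniqueEnds
  where
  uniqueEnds : Unique (map ends (cells F))
  uniqueEnds rewrite ends-inner F | lastOf-rest F =
    All.tabulate (λ { i refl → base-not-edge F p wd (chord⇒edge F i) })
      ∷ AllPairs.map proj₁ (chordsOf-apart F p)

HasCount-unique : ∀ {A : Set} {P : A → Set} {k l} → HasCount P k → HasCount P l → k ≡ l
HasCount-unique (L , uL , refl , L⇔) (M , uM , refl , M⇔) =
  ↭-length (∼bag⇒↭ (unique∧set⇒bag uL uM λ {x} →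
    mk⇔ (λ i → from (M⇔ x) (to (L⇔ x) i)) (λ i → from (L⇔ x) (to (M⇔ x) i))))

-- 3-periodic forests and their quiddities

Good : ∀ {o e} → Forest o e → Set
Good nil       = ⊤
Good (side F)  = Good F
Good (sub G F) = 3 ∣ length (verts G) × Good G × Good F

3∣⇒wide : ∀ {o e} (F : Forest o e) → 3 ∣ length (verts F) → Wide F
3∣⇒wide F d = ≤-pred (∣⇒≤ d)

good⇒proper : ∀ {o e} (F : Forest o e) → Good F → Proper F
good⇒proper nil g = tt
good⇒proper (side F) g = good⇒proper F g
good⇒proper (sub G F) (d , gG , gF) = 3∣⇒wide G d , good⇒proper G gG , good⇒proper F gF

inner⇒good : ∀ {o e} (F : Forest o e) → (∀ {V} → V ∈ inner F → 3 ∣ length V) → Good F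
inner⇒good nil h = tt
inner⇒good (side F) h = inner⇒good F h
inner⇒good (sub G F) h = h (here refl) , inner⇒good G (λ i → h (there (∈-++⁺ˡ i))) ,
  inner⇒good F (λ i → h (∈-++⁺ʳ (cells G) i))

good⇒inner : ∀ {o e V} (F : Forest o e) → Good F → V ∈ inner F → 3 ∣ length V
good⇒inner (side F) g i = good⇒inner F g i
good⇒inner (sub G F) (d , gG , gF) (here refl) = d
good⇒inner (sub G F) (d , gG , gF) (there i) with ∈-++⁻ (inner G) i
... | inj₁ j = good⇒inner G gG j
... | inj₂ j = good⇒inner F gF j

quid : ∀ e → Word → Vec ℕ (suc e)
quid e w = tabulate λ i → cnt 0 w (toℕ i)

module _ {e} (F : Forest 0 e) (p : Proper F) (wd : Wide F) (D : Dissection (suc e)) (rep : Represents F D) where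

  isCell⇔ : ∀ V → IsCell D V ⇔ (V ∈ cells F)
  isCell⇔ V = mk⇔ f g
    where
    f : IsCell D V → V ∈ cells F
    f (inc , bd , l , c) = cells-complete F p wd (inc , l , λ {u} {w} ui wi u<w →
      let h = rep u<w (≤-pred (All.lookup bd wi)) in
      mk⇔ (λ m → from h (to (c u w ui wi u<w) m)) (λ r → from (c u w ui wi u<w) (to h r)))
    g : V ∈ cells F → IsCell D V
    g i with cells-sound F p wd i
    ... | inc , l , c = inc , All.tabulate (λ j → s≤s (proj₂ (within-cells F p i j))) , l ,
      λ u w ui wi u<w →
      let h = rep u<w (proj₂ (within-cells F p i wi)) in
      mk⇔ (λ m → to h (to (c ui wi u<w) m)) (λ r → from (c ui wi u<w) (from h r))

  quid-isQuiddity : IsQuiddity D (quid e (word F))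
  quid-isQuiddity i = filter (x ∈ℕ?_) (cells F) ,
      Uniqueₚ.filter⁺ (x ∈ℕ?_) (cells-unique F p wd) ,
      trans (length-filter-∈ x (All.tabulate λ j → proj₁ (cells-sound F p wd j)))
        (trans (sym (cnt-word F x)) (sym (lookup∘tabulate (λ j → cnt 0 (word F) (toℕ j)) i))) ,
      λ V → mk⇔ (λ j → let a , b = ∈-filter⁻ (x ∈ℕ?_) j in from (isCell⇔ V) a , b)
                (λ { (c , j) → ∈-filter⁺ (x ∈ℕ?_) (to (isCell⇔ V) c) j })
    where x = toℕ i

-- `Good` constrains the inner cells only, so the size of the root cell is a condition of its own.
-- By `HasCount-unique` a dissection has no quiddity besides the one read off its word.
quiddity⇔word : ∀ {e} → 1 < e → (a : Vec ℕ (suc e)) →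
  (∃ λ (D : Dissection (suc e)) → ThreePeriodic D × IsQuiddity D a) ⇔
  (Σ (Forest 0 e) λ F → 3 ∣ length (verts F) × Good F × a ≡ quid e (word F))
quiddity⇔word {e} 1<e a = mk⇔ f g
  where
  f : (∃ λ (D : Dissection (suc e)) → ThreePeriodic D × IsQuiddity D a) →
      Σ (Forest 0 e) λ F → 3 ∣ length (verts F) × Good F × a ≡ quid e (word F)
  f (D , tp , q) with dissection⇒forest 1<e D
  ... | F , p , wd , rep = F , tp _ (from (isCell⇔ F p wd D rep _) (here refl)) ,
    inner⇒good F (λ {V} i → tp V (from (isCell⇔ F p wd D rep V) (there i))) ,
    trans (sym (tabulate∘lookup a)) (trans
      (tabulate-cong λ i → HasCount-unique (q i) (quid-isQuiddity F p wd D rep i))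
      (tabulate∘lookup (quid e (word F))))
  g : (Σ (Forest 0 e) λ F → 3 ∣ length (verts F) × Good F × a ≡ quid e (word F)) →
      ∃ λ (D : Dissection (suc e)) → ThreePeriodic D × IsQuiddity D a
  g (F , d , good , refl) with forest⇒dissection F (good⇒proper F good) (3∣⇒wide F d)
  ... | D , rep = D , tp , quid-isQuiddity F p wd D rep
    where
    p = good⇒proper F good
    wd = 3∣⇒wide F d
    three : ∀ {V} → V ∈ cells F → 3 ∣ length V
    three (here refl) = d
    three (there i) = good⇒inner F good i
    tp : ThreePeriodic D
    tp V c = three (to (isCell⇔ F p wd D rep V) c)

-- Canonical trees

-- The children of a node are b c | b c leaf b c | b c leaf b c leaf b c | …
data Block : Set
data Node  : Set
data Block where
  leaf : Block
  node : Node → Block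
data Node where
  end  : Block → Block → Node
  more : Block → Block → Node → Node

-- The argument k is the word that follows; this makes parsing a direct recursion.
blockWord : Block → Word → Word
nodeWord  : Node → Word → Word
blockWord leaf     k = S ∷ k
blockWord (node v) k = nodeWord v k
nodeWord (end b c)    k = T ∷ blockWord b (T ∷ blockWord c (T ∷ k))
nodeWord (more b c v) k = T ∷ blockWord b (T ∷ blockWord c (T ∷ S ∷ nodeWord v k))

steps : List Block → Word → Word
steps []       k = k
steps (b ∷ bs) k = T ∷ blockWord b (steps bs k)

rootWord : List Block → Word
rootWord bs = steps bs (T ∷ [])

data StartsT : Word → Set where
  startsT : ∀ {w} → StartsT (T ∷ w)

-- The first letter separates a leaf from a node. After `T b T c T` the next letter separates the
-- two kinds of node: `more` goes on with `S`, while `end` is followed by the continuation, which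
-- starts with `T`.
blockWord-injective : ∀ b b′ {k k′} → StartsT k → StartsT k′ → blockWord b k ≡ blockWord b′ k′ → b ≡ b′ × k ≡ k′
nodeWord-injective  : ∀ v v′ {k k′} → StartsT k → StartsT k′ → nodeWord v k ≡ nodeWord v′ k′ → v ≡ v′ × k ≡ k′
blockWord-injective leaf leaf _ _ refl = refl , refl
blockWord-injective leaf (node (end _ _)) _ _ ()
blockWord-injective leaf (node (more _ _ _)) _ _ ()
blockWord-injective (node (end _ _)) leaf _ _ ()
blockWord-injective (node (more _ _ _)) leaf _ _ ()
blockWord-injective (node v) (node v′) n n′ eq with nodeWord-injective v v′ n n′ eq
... | refl , r = refl , r
nodeWord-injective (end b c) (end b′ c′) n n′ eq
  with blockWord-injective b b′ startsT startsT (∷-injectiveʳ eq)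
... | refl , eq₁ with blockWord-injective c c′ startsT startsT (∷-injectiveʳ eq₁)
... | refl , eq₂ = refl , ∷-injectiveʳ eq₂
nodeWord-injective (more b c v) (more b′ c′ v′) n n′ eq
  with blockWord-injective b b′ startsT startsT (∷-injectiveʳ eq)
... | refl , eq₁ with blockWord-injective c c′ startsT startsT (∷-injectiveʳ eq₁)
... | refl , eq₂ with nodeWord-injective v v′ n n′ (∷-injectiveʳ (∷-injectiveʳ eq₂))
... | refl , eq₃ = refl , eq₃
nodeWord-injective (end b c) (more b′ c′ v′) n n′ eq
  with blockWord-injective b b′ startsT startsT (∷-injectiveʳ eq)
... | refl , eq₁ with blockWord-injective c c′ startsT startsT (∷-injectiveʳ eq₁)
nodeWord-injective (end b c) (more b′ c′ v′) () n′ eq | refl , eq₁ | refl , refl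
nodeWord-injective (more b c v) (end b′ c′) n n′ eq
  with blockWord-injective b b′ startsT startsT (∷-injectiveʳ eq)
... | refl , eq₁ with blockWord-injective c c′ startsT startsT (∷-injectiveʳ eq₁)
nodeWord-injective (more b c v) (end b′ c′) n () eq | refl , eq₁ | refl , refl

blockWord≢[] : ∀ b {k} → blockWord b k ≢ []
blockWord≢[] leaf ()
blockWord≢[] (node (end _ _)) ()
blockWord≢[] (node (more _ _ _)) ()

rootWord-startsT : ∀ bs → StartsT (rootWord bs)
rootWord-startsT []       = startsT
rootWord-startsT (b ∷ bs) = startsT

rootWord-injective : ∀ bs bs′ → rootWord bs ≡ rootWord bs′ → bs ≡ bs′
rootWord-injective [] [] _ = refl
rootWord-injective [] (b ∷ bs) eq = contradiction (sym (∷-injectiveʳ eq)) (blockWord≢[] b)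
rootWord-injective (b ∷ bs) [] eq = contradiction (∷-injectiveʳ eq) (blockWord≢[] b)
rootWord-injective (b ∷ bs) (b′ ∷ bs′) eq
  with blockWord-injective b b′ (rootWord-startsT bs) (rootWord-startsT bs′) (∷-injectiveʳ eq)
... | refl , eq′ = cong (b ∷_) (rootWord-injective bs bs′ eq′)

-- Reduction of words to canonical form, and back to forests

kids : Node → List Block
kids (end b c)    = b ∷ c ∷ []
kids (more b c v) = b ∷ c ∷ leaf ∷ kids v

-- A node and the bare sequence of its children have the same letters, which is why a node can be
-- dissolved among its siblings.
steps-kids : ∀ v k → steps (kids v) (T ∷ k) ≡ nodeWord v k
steps-kids (end b c) k = refl
steps-kids (more b c v) k = cong (λ w → T ∷ blockWord b (T ∷ blockWord c (T ∷ S ∷ w))) (steps-kids v k)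

steps-++ : ∀ bs cs k → steps (bs ++ cs) k ≡ steps bs (steps cs k)
steps-++ [] cs k = refl
steps-++ (b ∷ bs) cs k = cong (λ w → T ∷ blockWord b w) (steps-++ bs cs k)

3∣3+ : ∀ {n} → 3 ∣ n → 3 ∣ 3 + n
3∣3+ d = ∣m∣n⇒∣m+n ∣-refl d

3∣kids : ∀ v → 3 ∣ suc (length (kids v))
3∣kids (end b c) = ∣-refl
3∣kids (more b c v) = 3∣3+ (3∣kids v)

-- T·(T b T c T · x · w) with x a nonleaf child is regrouped as T·(T b T c T) followed by the
-- children of x, which become siblings.
absorb : ∀ cs → 3 ∣ suc (length cs) → Σ (Node × List Block) λ (v , ds) →
         3 ∣ length ds × (∀ k → steps cs (T ∷ k) ≡ nodeWord v (steps ds k))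
absorb [] d = contradiction d (>⇒∤ (s≤s (s≤s z≤n)))
absorb (_ ∷ []) d = contradiction d (>⇒∤ (s≤s (s≤s (s≤s z≤n))))
absorb (b ∷ c ∷ []) d = (end b c , []) , 3 ∣0 , λ k → refl
absorb (b ∷ c ∷ x ∷ cs) d with absorb cs (∣m+n∣m⇒∣n d ∣-refl)
absorb (b ∷ c ∷ leaf ∷ cs) d | (v , ds) , l , eq =
  (more b c v , ds) , l , λ k → cong (λ w → T ∷ blockWord b (T ∷ blockWord c (T ∷ S ∷ w))) (eq k)
absorb (b ∷ c ∷ node u ∷ cs) d | (v , ds) , l , eq =
  (end b c , kids u ++ node v ∷ ds) ,
  subst (3 ∣_) (sym (trans (length-++ (kids u)) (+-suc _ _))) (∣m∣n⇒∣m+n (3∣kids u) l) ,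
  λ k → cong (λ w → T ∷ blockWord b (T ∷ blockWord c (T ∷ w))) (begin
    nodeWord u (steps cs (T ∷ k))               ≡⟨ steps-kids u _ ⟨
    steps (kids u) (T ∷ steps cs (T ∷ k))       ≡⟨ cong (λ w → steps (kids u) (T ∷ w)) (eq k) ⟩
    steps (kids u) (steps (node v ∷ ds) k)      ≡⟨ steps-++ (kids u) (node v ∷ ds) k ⟨
    steps (kids u ++ node v ∷ ds) k             ∎)
  where open ≡-Reasoning

-- Only the residue modulo 3 of the number of children is preserved. The offset `m` expresses this
-- through divisibility alone: in the induction, a child already passed is counted in `m`.
normalise : ∀ {o e} (F : Forest o e) → Good F → Σ (List Block) λ bs →
            (∀ m → 3 ∣ m + length (rest F) → 3 ∣ m + length bs) × (∀ k → word F ++ k ≡ steps bs (T ∷ k))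
normalise nil g = [] , (λ m d → d) , λ k → refl
normalise (side F) g with normalise F g
... | bs , l , eq = leaf ∷ bs ,
  (λ m d → subst (3 ∣_) (sym (+-suc m _)) (l (suc m) (subst (3 ∣_) (+-suc m _) d))) ,
  λ k → cong (λ w → T ∷ S ∷ w) (eq k)
normalise (sub G F) (d₀ , gG , gF) with normalise G gG | normalise F gF
... | cs , lc , eqc | bs , lb , eqb with absorb cs (lc 1 d₀)
-- The cell below the chord becomes `node v`; the blocks `ds` that it cannot keep turn into further
-- children of the cell above.
... | (v , ds) , ld , eqd = node v ∷ ds ++ bs ,
  (λ m d → subst (3 ∣_) (arr m) (∣m∣n⇒∣m+n ld (lb (suc m) (subst (3 ∣_) (+-suc m _) d)))) ,
  λ k → cong (T ∷_) (begin
    (word G ++ word F) ++ k             ≡⟨ ++-assoc (word G) (word F) k ⟩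
    word G ++ word F ++ k               ≡⟨ eqc (word F ++ k) ⟩
    steps cs (T ∷ word F ++ k)          ≡⟨ eqd (word F ++ k) ⟩
    nodeWord v (steps ds (word F ++ k)) ≡⟨ cong (λ w → nodeWord v (steps ds w)) (eqb k) ⟩
    nodeWord v (steps ds (steps bs (T ∷ k))) ≡⟨ cong (nodeWord v) (steps-++ ds bs (T ∷ k)) ⟨
    nodeWord v (steps (ds ++ bs) (T ∷ k)) ∎)
  where
  open ≡-Reasoning
  shuffle : ∀ x m y → x + (suc m + y) ≡ m + suc (x + y)
  shuffle = solve-∀
  arr : ∀ m → length ds + (suc m + length bs) ≡ m + length (node v ∷ ds ++ bs)
  arr m = trans (shuffle (length ds) m (length bs)) (cong (λ z → m + suc z) (sym (length-++ ds)))

-- Where a block ends is known only after it has been laid out from `o`. It is therefore represented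
-- as an operation that prefixes it to any forest starting at its end.
record Step (b : Block) (o : ℕ) : Set where
  field
    target : ℕ
    step   : ∀ {e} → Forest target e → Forest o e
    step-good : ∀ {e} (F : Forest target e) → Good F → Good (step F)
    step-length : ∀ {e} (F : Forest target e) → length (rest (step F)) ≡ suc (length (rest F))
    step-word : ∀ {e} (F : Forest target e) k → word (step F) ++ k ≡ T ∷ blockWord b (word F ++ k)

blockStep  : ∀ b o → Step b o
nodeForest : ∀ v o → Σ ℕ λ e → Σ (Forest o e) λ F →
             3 ∣ length (verts F) × Good F × (∀ k → word F ++ k ≡ nodeWord v k)
blockStep leaf o = record
  { target = suc o ; step = side ; step-good = λ F g → g ; step-length = λ F → refl ; step-word = λ F k → refl }
blockStep (node v) o with nodeForest v o
... | b , G , d , g , eq = record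
  { target = b ; step = sub G ; step-good = λ F gF → d , g , gF ; step-length = λ F → refl
  ; step-word = λ F k → cong (T ∷_) (trans (++-assoc (word G) (word F) k) (eq (word F ++ k))) }
nodeForest (end b c) o = _ , X.step (Y.step nil) ,
  subst (λ l → 3 ∣ suc l) (sym (trans (X.step-length _) (cong suc (Y.step-length _)))) ∣-refl ,
  X.step-good _ (Y.step-good _ tt) ,
  λ k → trans (X.step-word _ k) (cong (λ w → T ∷ blockWord b w) (Y.step-word nil k))
  where
  module X = Step (blockStep b o)
  module Y = Step (blockStep c X.target)
nodeForest (more b c v) o with blockStep b o
... | x with blockStep c (Step.target x)
... | y with nodeForest v (suc (Step.target y))
... | e , G , d , g , eq = e , X.step (Y.step (side G)) ,
  subst (λ l → 3 ∣ suc l) (sym (trans (X.step-length _) (cong suc (Y.step-length _)))) (3∣3+ d) ,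
  X.step-good _ (Y.step-good _ g) ,
  λ k → trans (X.step-word _ k) (cong (λ w → T ∷ blockWord b w) (trans (Y.step-word _ k)
    (cong (λ w → T ∷ blockWord c (T ∷ S ∷ w)) (eq k))))
  where
  module X = Step x
  module Y = Step y

rootForest : ∀ bs o → Σ ℕ λ e → Σ (Forest o e) λ F →
             length (rest F) ≡ length bs × Good F × (∀ k → word F ++ k ≡ steps bs (T ∷ k))
rootForest [] o = o , nil , refl , tt , λ k → refl
rootForest (b ∷ bs) o with rootForest bs (Step.target (blockStep b o))
... | e , F , l , g , eq = e , X.step F , trans (X.step-length F) (cong suc l) , X.step-good F g ,
  λ k → trans (X.step-word F k) (cong (λ w → T ∷ blockWord b w) (eq k))
  where module X = Step (blockStep b o)

sides : Word → ℕ
sides []      = 0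
sides (T ∷ w) = sides w
sides (S ∷ w) = suc (sides w)

sides-word : ∀ {o e} (F : Forest o e) k → sides (word F ++ k) + o ≡ sides k + e
sides-word nil k = refl
sides-word {o} (side F) k = trans (sym (+-suc _ o)) (sides-word F k)
sides-word {o} (sub {b = b} G F) k = trans (cong (λ w → sides w + o) (++-assoc (word G) (word F) k))
  (trans (sides-word G (word F ++ k)) (sides-word F k))

-- The two sides share a word, not a tree: the forest and the canonical root may describe different
-- dissections with the same quiddity.
good-word⇔ : ∀ {e} (w : Word) →
  (Σ (Forest 0 e) λ F → 3 ∣ length (verts F) × Good F × w ≡ word F) ⇔
  (Σ (List Block) λ bs → 3 ∣ suc (length bs) × sides w ≡ e × w ≡ rootWord bs)
good-word⇔ {e} w = mk⇔ f g
  where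
  sides-forest : ∀ {e} (F : Forest 0 e) → sides (word F) ≡ e
  sides-forest F = trans (sym (trans (+-identityʳ _) (cong sides (++-identityʳ (word F))))) (sides-word F [])
  f : (Σ (Forest 0 e) λ F → 3 ∣ length (verts F) × Good F × w ≡ word F) →
      Σ (List Block) λ bs → 3 ∣ suc (length bs) × sides w ≡ e × w ≡ rootWord bs
  f (F , d , g , refl) with normalise F g
  ... | bs , l , eq = bs , l 1 d , sides-forest F , trans (sym (++-identityʳ (word F))) (eq [])
  g : (Σ (List Block) λ bs → 3 ∣ suc (length bs) × sides w ≡ e × w ≡ rootWord bs) →
      Σ (Forest 0 e) λ F → 3 ∣ length (verts F) × Good F × w ≡ word F
  g (bs , d , refl , refl) with rootForest bs 0
  ... | e′ , F , l , good , eq with trans (sym (++-identityʳ (word F))) (eq [])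
  -- The layout produces its own last vertex; counting the letters `S` identifies it with the
  -- required one.
  ... | weq with trans (sym (sides-forest F)) (cong sides weq)
  ... | refl = F , subst (λ z → 3 ∣ suc z) (sym l) d , good , sym weq

-- A word is determined by its tuple

cnt-below : ∀ {o x} w → x < o → cnt o w x ≡ 0
cnt-below [] x<o = refl
cnt-below {o} {x} (T ∷ w) x<o = cong₂ _+_ (δ-≢ o x λ { refl → <-irrefl refl x<o }) (cnt-below w x<o)
cnt-below (S ∷ w) x<o = cnt-below w (m≤n⇒m≤1+n x<o)

-- Where one word has `T` and the other has `S` or ends, the entry at the current vertex is positive
-- for the first and 0 for the second.
cnt-injective : ∀ o w w′ → sides w ≡ sides w′ →
                (∀ x → o ≤ x → x ≤ sides w + o → cnt o w x ≡ cnt o w′ x) → w ≡ w′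
cnt-injective o [] [] s h = refl
cnt-injective o [] (T ∷ w′) s h =
  contradiction (trans (h o ≤-refl ≤-refl) (cong (_+ cnt o w′ o) (δ-refl o))) 0≢1+n
cnt-injective o (T ∷ w) [] s h =
  contradiction (trans (sym (h o ≤-refl (m≤n+m o _))) (cong (_+ cnt o w o) (δ-refl o))) 0≢1+n
cnt-injective o (T ∷ w) (T ∷ w′) s h =
  cong (T ∷_) (cnt-injective o w w′ s λ x a b → +-cancelˡ-≡ (δ o x) _ _ (h x a b))
cnt-injective o (T ∷ w) (S ∷ w′) s h = contradiction
  (trans (sym (trans (h o ≤-refl (m≤n+m o _)) (cnt-below w′ (n<1+n o)))) (cong (_+ cnt o w o) (δ-refl o))) 0≢1+n
cnt-injective o (S ∷ w) (T ∷ w′) s h = contradiction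
  (trans (trans (sym (cnt-below w (n<1+n o))) (h o ≤-refl (m≤n+m o _))) (cong (_+ cnt o w′ o) (δ-refl o))) 0≢1+n
cnt-injective o (S ∷ w) (S ∷ w′) s h = cong (S ∷_) (cnt-injective (suc o) w w′ (suc-injective s)
  λ x a b → h x (<⇒≤ a) (≤-trans b (≤-reflexive (+-suc _ o))))

quid-injective : ∀ {e} w w′ → sides w ≡ e → sides w′ ≡ e → quid e w ≡ quid e w′ → w ≡ w′
quid-injective {e} w w′ s s′ eq = cnt-injective 0 w w′ (trans s (sym s′)) h
  where
  h : ∀ x → 0 ≤ x → x ≤ sides w + 0 → cnt 0 w x ≡ cnt 0 w′ x
  h x _ x≤ with fromℕ< (s≤s (subst (x ≤_) (trans (+-identityʳ _) s) x≤))
             | toℕ-fromℕ< (s≤s (subst (x ≤_) (trans (+-identityʳ _) s) x≤))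
  ... | i | refl = trans (sym (lookup∘tabulate {n = suc e} (λ j → cnt 0 w (toℕ j)) i))
    (trans (cong (λ v → lookup v i) eq) (lookup∘tabulate (λ j → cnt 0 w′ (toℕ j)) i))

-- Enumeration of canonical trees

-- Every node has exactly one `end`, so the first statistic counts cells; the second counts the
-- triples of children beyond the first two. They are the exponents of x and w.
blockNodes blockMores : Block → ℕ
nodeNodes  nodeMores  : Node → ℕ
blockNodes leaf     = 0
blockNodes (node v) = nodeNodes v
nodeNodes (end b c)    = suc (blockNodes b + blockNodes c)
nodeNodes (more b c v) = nodeNodes v + (blockNodes b + blockNodes c)
blockMores leaf     = 0
blockMores (node v) = nodeMores v
nodeMores (end b c)    = blockMores b + blockMores c
nodeMores (more b c v) = suc (nodeMores v + (blockMores b + blockMores c))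

nodes mores : List Block → ℕ
nodes []       = 0
nodes (b ∷ bs) = blockNodes b + nodes bs
mores []       = 0
mores (b ∷ bs) = blockMores b + mores bs

-- A cell with 2 + 3m children replaces one leaf by 2 + 3m, so it contributes 1 + 3m to the number
-- of leaves.
sides-block : ∀ b k → sides (blockWord b k) ≡ suc (blockNodes b + 3 * blockMores b) + sides k
sides-node  : ∀ v k → sides (nodeWord v k) ≡ suc (nodeNodes v + 3 * nodeMores v) + sides k
sides-block leaf k = refl
sides-block (node v) k = sides-node v k
sides-node (end b c) k =
  trans (sides-block b _) (trans (cong (suc (blockNodes b + 3 * blockMores b) +_) (sides-block c _))
    (shuffle (blockNodes b) (blockMores b) (blockNodes c) (blockMores c) (sides k)))
  where
  shuffle : ∀ i m i′ m′ x → suc (i + 3 * m) + (suc (i′ + 3 * m′) + x) ≡ suc (suc (i + i′) + 3 * (m + m′)) + x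
  shuffle = solve-∀
sides-node (more b c v) k =
  trans (sides-block b _) (trans (cong (suc (blockNodes b + 3 * blockMores b) +_)
      (trans (sides-block c _) (cong (λ t → suc (blockNodes c + 3 * blockMores c) + suc t) (sides-node v k))))
    (shuffle (blockNodes b) (blockMores b) (blockNodes c) (blockMores c) (nodeNodes v) (nodeMores v) (sides k)))
  where
  shuffle : ∀ i m i′ m′ j n x → suc (i + 3 * m) + (suc (i′ + 3 * m′) + suc (suc (j + 3 * n) + x)) ≡
            suc (j + (i + i′) + 3 * suc (n + (m + m′))) + x
  shuffle = solve-∀

sides-root : ∀ bs → sides (rootWord bs) ≡ length bs + (nodes bs + 3 * mores bs)
sides-root [] = refl
sides-root (b ∷ bs) = trans (sides-block b _) (trans (cong (suc (blockNodes b + 3 * blockMores b) +_) (sides-root bs))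
  (shuffle (blockNodes b) (blockMores b) (length bs) (nodes bs) (mores bs)))
  where
  shuffle : ∀ i m l j n → suc (i + 3 * m) + (l + (j + 3 * n)) ≡ suc l + (i + j + 3 * (m + n))
  shuffle = solve-∀

consNode : ∀ {a} → Node × Vec Block a → Vec Block (suc a)
consNode (v , bs) = node v ∷ bs

closeEnd : ∀ {a} → Vec Block (2 + a) → Node × Vec Block a
closeEnd (b ∷ c ∷ bs) = end b c , bs

-- The tail `v` of the new node is put in front, so that the argument is again a tuple headed by a
-- node and `heads` can recur on itself.
closeMore : ∀ {a} → Node × Vec Block (2 + a) → Node × Vec Block a
closeMore (v , b ∷ c ∷ bs) = more b c v , bs

-- All a-tuples of blocks with i nodes and s uses of `more`; heads lists those
-- (a+1)-tuples whose first block is a node.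
tuples : (a i s : ℕ) → List (Vec Block a)
heads  : (a i s : ℕ) → List (Node × Vec Block a)
tuples zero    zero    zero    = [] ∷ []
tuples zero    zero    (suc s) = []
tuples zero    (suc i) s       = []
tuples (suc a) i       s       = map (leaf ∷_) (tuples a i s) ++ map consNode (heads a i s)
heads a zero    s       = []
heads a (suc i) zero    = map closeEnd (tuples (2 + a) i zero)
heads a (suc i) (suc s) = map closeEnd (tuples (2 + a) i (suc s)) ++ map closeMore (heads (2 + a) (suc i) s)

nodesᵛ moresᵛ : ∀ {a} → Vec Block a → ℕ
nodesᵛ []       = 0
nodesᵛ (b ∷ bs) = blockNodes b + nodesᵛ bs
moresᵛ []       = 0
moresᵛ (b ∷ bs) = blockMores b + moresᵛ bs

nodesᵛ-toList : ∀ {a} (bs : Vec Block a) → nodes (toList bs) ≡ nodesᵛ bs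
nodesᵛ-toList [] = refl
nodesᵛ-toList (b ∷ bs) = cong (blockNodes b +_) (nodesᵛ-toList bs)

moresᵛ-toList : ∀ {a} (bs : Vec Block a) → mores (toList bs) ≡ moresᵛ bs
moresᵛ-toList [] = refl
moresᵛ-toList (b ∷ bs) = cong (blockMores b +_) (moresᵛ-toList bs)

Stats : ∀ {a} → ℕ → ℕ → Vec Block a → Set
Stats i s bs = nodesᵛ bs ≡ i × moresᵛ bs ≡ s

end-nodes : ∀ {a} b c (bs : Vec Block a) → suc (nodesᵛ (b ∷ c ∷ bs)) ≡ nodesᵛ (node (end b c) ∷ bs)
end-nodes b c bs = cong suc (sym (+-assoc (blockNodes b) _ _))

end-mores : ∀ {a} b c (bs : Vec Block a) → moresᵛ (b ∷ c ∷ bs) ≡ moresᵛ (node (end b c) ∷ bs)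
end-mores b c bs = sym (+-assoc (blockMores b) _ _)

more-nodes : ∀ {a} b c v (bs : Vec Block a) → nodesᵛ (node v ∷ b ∷ c ∷ bs) ≡ nodesᵛ (node (more b c v) ∷ bs)
more-nodes b c v bs = shuffle (nodeNodes v) (blockNodes b) (blockNodes c) (nodesᵛ bs)
  where
  shuffle : ∀ v b c x → v + (b + (c + x)) ≡ v + (b + c) + x
  shuffle = solve-∀

more-mores : ∀ {a} b c v (bs : Vec Block a) → suc (moresᵛ (node v ∷ b ∷ c ∷ bs)) ≡ moresᵛ (node (more b c v) ∷ bs)
more-mores b c v bs = shuffle (nodeMores v) (blockMores b) (blockMores c) (moresᵛ bs)
  where
  shuffle : ∀ v b c x → suc (v + (b + (c + x))) ≡ suc (v + (b + c)) + x
  shuffle = solve-∀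

closeEnd-stats : ∀ {a i s} (x : Vec Block (2 + a)) → Stats i s x → Stats (suc i) s (consNode (closeEnd x))
closeEnd-stats (b ∷ c ∷ bs) (p , q) = trans (sym (end-nodes b c bs)) (cong suc p) , trans (sym (end-mores b c bs)) q

closeMore-stats : ∀ {a i s} (x : Node × Vec Block (2 + a)) →
                  Stats i s (consNode x) → Stats i (suc s) (consNode (closeMore x))
closeMore-stats (v , b ∷ c ∷ bs) (p , q) =
  trans (sym (more-nodes b c v bs)) p , trans (sym (more-mores b c v bs)) (cong suc q)

tuples-sound : ∀ a i s → All (Stats i s) (tuples a i s)
heads-sound  : ∀ a i s → All (λ vbs → Stats i s (consNode vbs)) (heads a i s)
tuples-sound zero    zero    zero    = (refl , refl) ∷ []
tuples-sound zero    zero    (suc s) = []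
tuples-sound zero    (suc i) s       = []
tuples-sound (suc a) i s = Allₚ.++⁺ (Allₚ.map⁺ (tuples-sound a i s)) (Allₚ.map⁺ (heads-sound a i s))
heads-sound a zero s = []
heads-sound a (suc i) zero =
  Allₚ.map⁺ (All.map (λ {x} → closeEnd-stats x) (tuples-sound (2 + a) i zero))
heads-sound a (suc i) (suc s) = Allₚ.++⁺
  (Allₚ.map⁺ (All.map (λ {x} → closeEnd-stats x) (tuples-sound (2 + a) i (suc s))))
  (Allₚ.map⁺ (All.map (λ {x} → closeMore-stats x) (heads-sound (2 + a) (suc i) s)))

nodeNodes>0 : ∀ v → 0 < nodeNodes v
nodeNodes>0 (end b c) = s≤s z≤n
nodeNodes>0 (more b c v) = ≤-trans (nodeNodes>0 v) (m≤m+n _ _)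

tuples-complete : ∀ a i s (bs : Vec Block a) → Stats i s bs → bs ∈ tuples a i s
heads-complete  : ∀ a i s v (bs : Vec Block a) → Stats i s (node v ∷ bs) → (v , bs) ∈ heads a i s
tuples-complete zero i s [] (refl , refl) = here refl
tuples-complete (suc a) i s (leaf ∷ bs) st = ∈-++⁺ˡ (∈-map⁺ (leaf ∷_) (tuples-complete a i s bs st))
tuples-complete (suc a) i s (node v ∷ bs) st =
  ∈-++⁺ʳ (map (leaf ∷_) (tuples a i s)) (∈-map⁺ consNode (heads-complete a i s v bs st))
heads-complete a zero s v bs (p , q) =
  contradiction (≤-trans (nodeNodes>0 v) (m≤m+n _ _)) (λ lt → <-irrefl refl (≤-trans lt (≤-reflexive p)))
heads-complete a (suc i) zero (end b c) bs (p , q) = ∈-map⁺ closeEnd (tuples-complete (2 + a) i zero (b ∷ c ∷ bs)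
  (suc-injective (trans (end-nodes b c bs) p) , trans (end-mores b c bs) q))
heads-complete a (suc i) (suc s) (end b c) bs (p , q) = ∈-++⁺ˡ (∈-map⁺ closeEnd (tuples-complete (2 + a) i (suc s) (b ∷ c ∷ bs)
  (suc-injective (trans (end-nodes b c bs) p) , trans (end-mores b c bs) q)))
heads-complete a (suc i) zero (more b c v) bs (p , ())
heads-complete a (suc i) (suc s) (more b c v) bs (p , q) =
  ∈-++⁺ʳ (map closeEnd (tuples (2 + a) i (suc s))) (∈-map⁺ closeMore (heads-complete (2 + a) (suc i) s v (b ∷ c ∷ bs)
  (trans (more-nodes b c v bs) p , suc-injective (trans (more-mores b c v bs) q))))

tuples-unique : ∀ a i s → Unique (tuples a i s)
heads-unique  : ∀ a i s → Unique (heads a i s)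
tuples-unique zero zero zero = [] ∷ []
tuples-unique zero zero (suc s) = []
tuples-unique zero (suc i) s = []
tuples-unique (suc a) i s = Uniqueₚ.++⁺ (Uniqueₚ.map⁺ (λ { refl → refl }) (tuples-unique a i s))
  (Uniqueₚ.map⁺ (λ { refl → refl }) (heads-unique a i s)) disjoint
  where
  disjoint : ∀ {x} → x ∈ map (leaf ∷_) (tuples a i s) × x ∈ map consNode (heads a i s) → ⊥
  disjoint (m , n) with ∈-map⁻ (leaf ∷_) m | ∈-map⁻ consNode n
  ... | _ , _ , refl | _ , _ , ()
closeEnd-injective : ∀ {a} {x y : Vec Block (2 + a)} → closeEnd x ≡ closeEnd y → x ≡ y
closeEnd-injective {x = _ ∷ _ ∷ _} {_ ∷ _ ∷ _} refl = refl
closeMore-injective : ∀ {a} {x y : Node × Vec Block (2 + a)} → closeMore x ≡ closeMore y → x ≡ y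
closeMore-injective {x = _ , _ ∷ _ ∷ _} {_ , _ ∷ _ ∷ _} refl = refl
heads-unique a zero s = []
heads-unique a (suc i) zero = Uniqueₚ.map⁺ closeEnd-injective (tuples-unique (2 + a) i zero)
heads-unique a (suc i) (suc s) = Uniqueₚ.++⁺ (Uniqueₚ.map⁺ closeEnd-injective (tuples-unique (2 + a) i (suc s)))
  (Uniqueₚ.map⁺ closeMore-injective (heads-unique (2 + a) (suc i) s)) disjoint
  where
  disjoint : ∀ {x} → x ∈ map closeEnd (tuples (2 + a) i (suc s)) × x ∈ map closeMore (heads (2 + a) (suc i) s) → ⊥
  disjoint (m , n) with ∈-map⁻ closeEnd m | ∈-map⁻ closeMore n
  ... | _ ∷ _ ∷ _ , _ , refl | (_ , _ ∷ _ ∷ _) , _ , ()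

-- Canonical roots with a given number of leaves

collect : ∀ {A : Set} → ℕ → (ℕ → List A) → List A
collect zero    f = []
collect (suc m) f = collect m f ++ f m

∈-collect⁺ : ∀ {A : Set} m {f : ℕ → List A} {k x} → k < m → x ∈ f k → x ∈ collect m f
∈-collect⁺ (suc m) {f} {k} k<sm i with m≤n⇒m<n∨m≡n (≤-pred k<sm)
... | inj₁ k<m = ∈-++⁺ˡ (∈-collect⁺ m k<m i)
... | inj₂ refl = ∈-++⁺ʳ (collect m f) i

∈-collect⁻ : ∀ {A : Set} m {f : ℕ → List A} {x} → x ∈ collect m f → Σ ℕ λ k → k < m × x ∈ f k
∈-collect⁻ (suc m) {f} i with ∈-++⁻ (collect m f) i
... | inj₂ j = m , ≤-refl , j
... | inj₁ j with ∈-collect⁻ m j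
... | k , k<m , l = k , m≤n⇒m≤1+n k<m , l

collect-unique : ∀ {A : Set} m {f : ℕ → List A} → (∀ k → Unique (f k)) →
                 (∀ {k l x} → x ∈ f k → x ∈ f l → k ≡ l) → Unique (collect m f)
collect-unique zero u d = []
collect-unique (suc m) u d = Uniqueₚ.++⁺ (collect-unique m u d) (u m) λ (i , j) →
  let k , k<m , l = ∈-collect⁻ m i in <-irrefl (d l j) k<m

rootsWith : ℕ → ℕ → ℕ → List (List Block)
rootsWith a i s = map toList (tuples a i s)

∈-rootsWith : ∀ a i s {bs} → bs ∈ rootsWith a i s ⇔ (length bs ≡ a × nodes bs ≡ i × mores bs ≡ s)
∈-rootsWith a i s {bs} = mk⇔ f g
  where
  f : bs ∈ rootsWith a i s → length bs ≡ a × nodes bs ≡ i × mores bs ≡ s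
  f m with ∈-map⁻ toList m
  ... | v , n , eq with All.lookup (tuples-sound a i s) n
  ... | p , q = trans (cong length eq) (length-toList v) , trans (cong nodes eq) (trans (nodesᵛ-toList v) p) ,
    trans (cong mores eq) (trans (moresᵛ-toList v) q)
  g : length bs ≡ a × nodes bs ≡ i × mores bs ≡ s → bs ∈ rootsWith a i s
  g (refl , p , q) = subst (_∈ rootsWith a i s) (toList∘fromList bs)
    (∈-map⁺ toList (tuples-complete a i s (fromList bs)
      ( trans (sym (nodesᵛ-toList (fromList bs))) (trans (cong nodes (toList∘fromList bs)) p)
      , trans (sym (moresᵛ-toList (fromList bs))) (trans (cong mores (toList∘fromList bs)) q))))

toList-injectiveᵛ : ∀ {a} {x y : Vec Block a} → toList x ≡ toList y → x ≡ y
toList-injectiveᵛ {x = []} {[]} _ = refl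
toList-injectiveᵛ {x = b ∷ x} {c ∷ y} eq = cong₂ _∷_ (∷-injectiveˡ eq) (toList-injectiveᵛ (∷-injectiveʳ eq))

rootsWith-unique : ∀ a i s → Unique (rootsWith a i s)
rootsWith-unique a i s = Uniqueₚ.map⁺ toList-injectiveᵛ (tuples-unique a i s)

-- Here `k` counts the triples of children beyond the first two in all cells, `s` of them below the
-- root. The number of leaves is (3(k-s)+2) + (n-3k-1) + 3s = n+1.
rootsAt : ℕ → ℕ → List (List Block)
rootsAt n k = if does (3 * k <? n)
  then collect (suc k) (λ s → rootsWith (3 * (k ∸ s) + 2) (n ∸ (3 * k + 1)) s)
  else []

roots : ℕ → List (List Block)
roots n = collect n (rootsAt n)

if-true : ∀ {A P : Set} {x y : A} (P? : Dec P) → P → (if does P? then x else y) ≡ x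
if-true (yes _) _ = refl
if-true (no ¬p) p = contradiction p ¬p

if-false : ∀ {A P : Set} {x y : A} (P? : Dec P) → ¬ P → (if does P? then x else y) ≡ y
if-false (yes p) ¬p = contradiction p ¬p
if-false (no _) _ = refl

rootsAt-collect : ∀ n k → 3 * k < n →
  rootsAt n k ≡ collect (suc k) (λ s → rootsWith (3 * (k ∸ s) + 2) (n ∸ (3 * k + 1)) s)
rootsAt-collect n k = if-true (3 * k <? n)

rootsAt-[] : ∀ n k → ¬ 3 * k < n → rootsAt n k ≡ []
rootsAt-[] n k = if-false (3 * k <? n)

∈-rootsAt⁻ : ∀ n k {bs} → bs ∈ rootsAt n k →
  3 * k < n × mores bs ≤ k × length bs ≡ 3 * (k ∸ mores bs) + 2 × nodes bs ≡ n ∸ (3 * k + 1)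
∈-rootsAt⁻ n k {bs} m with 3 * k <? n
... | no ¬p = contradiction (subst (bs ∈_) (rootsAt-[] n k ¬p) m) λ ()
... | yes 3k<n with ∈-collect⁻ (suc k) (subst (bs ∈_) (rootsAt-collect n k 3k<n) m)
... | s , s<sk , i with to (∈-rootsWith (3 * (k ∸ s) + 2) (n ∸ (3 * k + 1)) s) i
... | p , q , refl = 3k<n , ≤-pred s<sk , p , q

∈-rootsAt⁺ : ∀ n k {bs} → 3 * k < n → mores bs ≤ k → length bs ≡ 3 * (k ∸ mores bs) + 2 →
  nodes bs ≡ n ∸ (3 * k + 1) → bs ∈ rootsAt n k
∈-rootsAt⁺ n k {bs} 3k<n ≤k p q = subst (bs ∈_) (sym (rootsAt-collect n k 3k<n))
  (∈-collect⁺ (suc k) (s≤s ≤k) (from (∈-rootsWith (3 * (k ∸ mores bs) + 2) (n ∸ (3 * k + 1)) (mores bs)) (p , q , refl)))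

rootsAt-unique : ∀ n k → Unique (rootsAt n k)
rootsAt-unique n k with 3 * k <? n
... | no ¬p = subst Unique (sym (rootsAt-[] n k ¬p)) []
... | yes 3k<n = subst Unique (sym (rootsAt-collect n k 3k<n))
  (collect-unique (suc k) (λ s → rootsWith-unique (3 * (k ∸ s) + 2) (n ∸ (3 * k + 1)) s) λ {s} {s′} i j →
    trans (sym (mores≡ s i)) (mores≡ s′ j))
  where
  mores≡ : ∀ s {bs} → bs ∈ rootsWith (3 * (k ∸ s) + 2) (n ∸ (3 * k + 1)) s → mores bs ≡ s
  mores≡ s i = proj₂ (proj₂ (to (∈-rootsWith (3 * (k ∸ s) + 2) (n ∸ (3 * k + 1)) s) i))

roots-unique : ∀ n → Unique (roots n)
roots-unique n = collect-unique n (rootsAt-unique n) λ {k} {l} i j →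
  let _ , s≤k , p , _ = ∈-rootsAt⁻ n k i
      _ , s≤l , q , _ = ∈-rootsAt⁻ n l j
  in ∸-cancelʳ-≡ s≤k s≤l (*-cancelˡ-≡ _ _ 3 (+-cancelʳ-≡ 2 _ _ (trans (sym p) q)))

∈-roots : ∀ n {bs} → bs ∈ roots n ⇔ (3 ∣ suc (length bs) × sides (rootWord bs) ≡ suc n)
∈-roots n {bs} = mk⇔ f g
  where
  f : bs ∈ roots n → 3 ∣ suc (length bs) × sides (rootWord bs) ≡ suc n
  f m with ∈-collect⁻ n m
  ... | k , _ , i with ∈-rootsAt⁻ n k i
  ... | 3k<n , s≤k , p , q =
      divides (suc (k ∸ s)) (trans (cong suc p) (arr₁ (k ∸ s))) ,
      trans (sides-root bs) (trans (cong₂ (λ x y → x + (y + 3 * s)) p q)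
        (trans (arr₂ (k ∸ s) s (n ∸ (3 * k + 1)))
          (trans (cong (λ z → suc (3 * z + 1 + (n ∸ (3 * k + 1)))) (m∸n+n≡m s≤k))
            (cong suc (m+[n∸m]≡n (subst (_≤ n) (+-comm 1 (3 * k)) 3k<n))))))
    where
    s = mores bs
    arr₁ : ∀ j → suc (3 * j + 2) ≡ suc j * 3
    arr₁ = solve-∀
    arr₂ : ∀ j s x → 3 * j + 2 + (x + 3 * s) ≡ suc (3 * (j + s) + 1 + x)
    arr₂ = solve-∀
  g : 3 ∣ suc (length bs) × sides (rootWord bs) ≡ suc n → bs ∈ roots n
  -- `j` is the number of triples at the root itself, so the index looked for is `k = j + s`.
  g (divides (suc j) eq , sd) = ∈-collect⁺ n (≤-trans (s≤s (m≤m+n k _)) 3k<n)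
      (∈-rootsAt⁺ n k 3k<n (m≤n+m s j)
        (trans len (cong (λ z → 3 * z + 2) (sym (m+n∸n≡m j s))))
        (sym (trans (cong (_∸ (3 * k + 1)) n≡) (m+n∸m≡n (3 * k + 1) (nodes bs)))))
    where
    s = mores bs
    k = j + s
    len : length bs ≡ 3 * j + 2
    len = suc-injective (trans eq (arr j))
      where
      arr : ∀ j → suc j * 3 ≡ suc (3 * j + 2)
      arr = solve-∀
    n≡ : n ≡ 3 * k + 1 + nodes bs
    n≡ = suc-injective (trans (sym sd) (trans (sides-root bs) (trans (cong (_+ (nodes bs + 3 * s)) len) (arr j s (nodes bs)))))
      where
      arr : ∀ j s x → 3 * j + 2 + (x + 3 * s) ≡ suc (3 * (j + s) + 1 + x)
      arr = solve-∀
    3k<n : 3 * k < n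
    3k<n = ≤-trans (≤-reflexive (+-comm 1 (3 * k))) (≤-trans (m≤m+n _ _) (≤-reflexive (sym n≡)))

-- Injectivity is asked for members only, because `quid-injective` compares words with the same
-- prescribed number of sides.
map-unique : ∀ {A B : Set} (f : A → B) {xs} → (∀ {x y} → x ∈ xs → y ∈ xs → f x ≡ f y → x ≡ y) →
             Unique xs → Unique (map f xs)
map-unique f inj [] = []
map-unique f {x ∷ xs} inj (a ∷ u) = All.tabulate h ∷ map-unique f (λ i j → inj (there i) (there j)) u
  where
  h : ∀ {y} → y ∈ map f xs → f x ≢ y
  h m eq with ∈-map⁻ f m
  ... | z , i , refl = All.lookup a i (inj (here refl) (there i) eq)

quiddity-count : ∀ n → 0 < n → HasCount (λ (a : Vec ℕ (suc (suc n))) →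
  ∃ λ (D : Dissection (suc (suc n))) → ThreePeriodic D × IsQuiddity D a) (length (roots n))
quiddity-count n 0<n = map q (roots n) , map-unique q inj (roots-unique n) , length-map q (roots n) , λ a → mk⇔ (f a) (g a)
  where
  q : List Block → Vec ℕ (suc (suc n))
  q bs = quid (suc n) (rootWord bs)
  inj : ∀ {x y} → x ∈ roots n → y ∈ roots n → q x ≡ q y → x ≡ y
  inj i j eq = rootWord-injective _ _ (quid-injective _ _ (proj₂ (to (∈-roots n) i)) (proj₂ (to (∈-roots n) j)) eq)
  f : ∀ a → a ∈ map q (roots n) → _
  f a m with ∈-map⁻ q m
  ... | bs , i , refl with to (∈-roots n) i
  ... | d , sd with from (good-word⇔ (rootWord bs)) (bs , d , sd , refl)
  ... | F , dF , gF , eq = from (quiddity⇔word (s≤s 0<n) _) (F , dF , gF , cong (quid (suc n)) eq)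
  g : ∀ a → _ → a ∈ map q (roots n)
  g a h with to (quiddity⇔word (s≤s 0<n) a) h
  ... | F , dF , gF , refl with to (good-word⇔ (word F)) (F , dF , gF , refl)
  ... | bs , d , sd , eq = subst (λ w → quid (suc n) w ∈ map q (roots n)) (sym eq)
    (∈-map⁺ q (from (∈-roots n {bs}) (d , subst (λ w → sides w ≡ suc n) eq sd)))

-- Closed form of the refined counts

#tuples #heads : ℕ → ℕ → ℕ → ℕ
#tuples a i s = length (tuples a i s)
#heads  a i s = length (heads a i s)

#tuples-suc : ∀ a i s → #tuples (suc a) i s ≡ #tuples a i s + #heads a i s
#tuples-suc a i s = trans (length-++ (map (leaf ∷_) (tuples a i s)))
  (cong₂ _+_ (length-map _ (tuples a i s)) (length-map consNode (heads a i s)))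

#heads-zero : ∀ a i → #heads a (suc i) 0 ≡ #tuples (2 + a) i 0
#heads-zero a i = length-map closeEnd (tuples (2 + a) i 0)

#heads-suc : ∀ a i s → #heads a (suc i) (suc s) ≡ #tuples (2 + a) i (suc s) + #heads (2 + a) (suc i) s
#heads-suc a i s = trans (length-++ (map closeEnd (tuples (2 + a) i (suc s))))
  (cong₂ _+_ (length-map closeEnd (tuples (2 + a) i (suc s))) (length-map closeMore (heads (2 + a) (suc i) s)))

#tuples-leaves : ∀ a → #tuples a 0 0 ≡ 1
#tuples-leaves zero = refl
#tuples-leaves (suc a) = trans (#tuples-suc a 0 0) (trans (+-identityʳ _) (#tuples-leaves a))

#tuples-no-nodes : ∀ a s → #tuples a 0 (suc s) ≡ 0
#tuples-no-nodes zero s = refl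
#tuples-no-nodes (suc a) s = trans (#tuples-suc a 0 (suc s)) (trans (+-identityʳ _) (#tuples-no-nodes a s))

-- The coefficientwise form of P^{a+1} = P^a + x P^{a+2} + w P^{a+3} - w P^{a+2}.
#tuples-rec : ∀ a i s → #tuples (suc a) (suc i) (suc s) + #tuples (2 + a) (suc i) s ≡
  #tuples a (suc i) (suc s) + #tuples (2 + a) i (suc s) + #tuples (3 + a) (suc i) s
#tuples-rec a i s = begin
  #tuples (suc a) (suc i) (suc s) + #tuples (2 + a) (suc i) s
    ≡⟨ cong (_+ #tuples (2 + a) (suc i) s) (trans (#tuples-suc a (suc i) (suc s)) (cong (#tuples a (suc i) (suc s) +_) (#heads-suc a i s))) ⟩
  #tuples a (suc i) (suc s) + (#tuples (2 + a) i (suc s) + #heads (2 + a) (suc i) s) + #tuples (2 + a) (suc i) s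
    ≡⟨ shuffle (#tuples a (suc i) (suc s)) (#tuples (2 + a) i (suc s)) (#heads (2 + a) (suc i) s) _ ⟩
  #tuples a (suc i) (suc s) + #tuples (2 + a) i (suc s) + (#tuples (2 + a) (suc i) s + #heads (2 + a) (suc i) s)
    ≡⟨ cong (#tuples a (suc i) (suc s) + #tuples (2 + a) i (suc s) +_) (#tuples-suc (2 + a) (suc i) s) ⟨
  #tuples a (suc i) (suc s) + #tuples (2 + a) i (suc s) + #tuples (3 + a) (suc i) s ∎
  where
  open ≡-Reasoning
  shuffle : ∀ x y z t → x + (y + z) + t ≡ x + y + (t + z)
  shuffle = solve-∀

-- The rising factorial. It is peeled off here at the low end and in `rise-last` at the high end; in
-- `#tuples-!` neighbouring terms share a middle part and differ by a factor at one of the two ends.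
rise : ℕ → ℕ → ℕ
rise b zero    = 1
rise b (suc r) = b * rise (suc b) r

rise-last : ∀ b r → rise b (suc r) ≡ rise b r * (b + r)
rise-last b zero = trans (*-identityʳ b) (sym (trans (*-identityˡ _) (+-identityʳ b)))
rise-last b (suc r) = trans (cong (b *_) (rise-last (suc b) r))
  (trans (sym (*-assoc b _ _)) (cong (b * rise (suc b) r *_) (sym (+-suc b r))))

rise-! : ∀ b r → rise (suc b) r * b ! ≡ (r + b) !
rise-! b zero = *-identityˡ (b !)
rise-! b (suc r) = begin
  rise (suc b) (suc r) * b !        ≡⟨ cong (_* b !) (rise-last (suc b) r) ⟩
  rise (suc b) r * (suc b + r) * b ! ≡⟨ shuffle (rise (suc b) r) (suc b + r) (b !) ⟩
  (suc b + r) * (rise (suc b) r * b !) ≡⟨ cong₂ _*_ (cong suc (+-comm b r)) (rise-! b r) ⟩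
  suc (r + b) * (r + b) !           ∎
  where
  open ≡-Reasoning
  shuffle : ∀ x y z → x * y * z ≡ y * (x * z)
  shuffle = solve-∀

C-! : ∀ b r → ((r + b) C r) * (r ! * b !) ≡ (r + b) !
C-! b r = begin
  ((r + b) C r) * (r ! * b !)  ≡⟨ cong (λ x → ((r + b) C r) * (r ! * x !)) (m+n∸m≡n r b) ⟨
  ((r + b) C r) * (r ! * (r + b ∸ r) !)
    ≡⟨ cong (_* (r ! * (r + b ∸ r) !)) (nCk≡n!/k![n-k]! (m≤m+n r b)) ⟩
  ((r + b) ! / (r ! * (r + b ∸ r) !)) {{_}} * (r ! * (r + b ∸ r) !)
    ≡⟨ m/n*n≡m {{r !* (r + b ∸ r) !≢0}} (k![n∸k]!∣n! (m≤m+n r b)) ⟩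
  (r + b) ! ∎
  where
  open ≡-Reasoning

C-rise : ∀ b r → ((r + b) C r) * r ! ≡ rise (suc b) r
C-rise b r = *-cancelʳ-≡ _ _ (b !) {{b !≢0}}
  (trans (*-assoc ((r + b) C r) (r !) (b !)) (trans (C-! b r) (sym (rise-! b r))))

-- The closed form for `i = suc j` with its denominators cleared. The numerator of the second
-- binomial has `suc j` factors, the lowest of which is the denominator `a + i + 2s`; `j` factors
-- remain in `rise`. The induction is lexicographic in `j`, `s`, `a`: the exponent grows only when
-- `j` or `s` drops.
#tuples-! : ∀ j s a → suc j ! * j ! * s ! * #tuples a (suc j) s ≡ a * (j + s) ! * rise (a + j + 2 * s + 2) j
#tuples-! j s zero = *-zeroʳ (suc j ! * j ! * s !)
#tuples-! zero zero (suc a) = begin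
  1 * #tuples (suc a) 1 0                 ≡⟨ *-identityˡ _ ⟩
  #tuples (suc a) 1 0                     ≡⟨ #tuples-suc a 1 0 ⟩
  #tuples a 1 0 + #heads a 1 0            ≡⟨ cong₂ _+_ (sym (*-identityˡ _)) (trans (#heads-zero a 0) (#tuples-leaves (2 + a))) ⟩
  1 * #tuples a 1 0 + 1                   ≡⟨ cong (_+ 1) (#tuples-! zero zero a) ⟩
  a * 1 * 1 + 1                           ≡⟨ arr a ⟩
  suc a * 1 * 1                           ∎
  where
  open ≡-Reasoning
  arr : ∀ a → a * 1 * 1 + 1 ≡ suc a * 1 * 1
  arr = solve-∀
#tuples-! (suc j) zero (suc a) = begin
  suc (suc j) ! * suc j ! * 1 * #tuples (suc a) (2 + j) 0
    ≡⟨ cong (suc (suc j) ! * suc j ! * 1 *_) (trans (#tuples-suc a (2 + j) 0) (cong (#tuples a (2 + j) 0 +_) (#heads-zero a (suc j)))) ⟩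
  suc (suc j) ! * suc j ! * 1 * (#tuples a (2 + j) 0 + #tuples (2 + a) (suc j) 0)
    ≡⟨ split j (suc j !) (j !) (#tuples a (2 + j) 0) (#tuples (2 + a) (suc j) 0) ⟩
  suc (suc j) ! * suc j ! * 1 * #tuples a (2 + j) 0 + (2 + j) * suc j * (suc j ! * j ! * 1 * #tuples (2 + a) (suc j) 0)
    ≡⟨ cong₂ (λ x y → x + (2 + j) * suc j * y) (#tuples-! (suc j) zero a) (#tuples-! j zero (2 + a)) ⟩
  a * (suc j + 0) ! * (β * rise (suc β) j) + (2 + j) * suc j * ((2 + a) * (j + 0) ! * rise (2 + a + j + 0 + 2) j)
    ≡⟨ cong (λ x → a * (suc j + 0) ! * (β * rise (suc β) j) + (2 + j) * suc j * ((2 + a) * (j + 0) ! * rise x j)) (β₁ a j) ⟩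
  a * (suc (j + 0) * (j + 0) !) * (β * Y) + (2 + j) * suc j * ((2 + a) * (j + 0) ! * Y)
    ≡⟨ final a j ((j + 0) !) Y ⟩
  suc a * (suc (j + 0) * (j + 0) !) * (Y * (suc β + j))
    ≡⟨ cong (suc a * (suc j + 0) ! *_) (rise-last (suc β) j) ⟨
  suc a * (suc j + 0) ! * rise (suc β) (suc j) ∎
  where
  open ≡-Reasoning
  β = a + suc j + 0 + 2
  Y = rise (suc β) j
  β₁ : ∀ a j → 2 + a + j + 0 + 2 ≡ suc (a + suc j + 0 + 2)
  β₁ = solve-∀
  split : ∀ j u v x y → (2 + j) * u * (suc j * v) * 1 * (x + y) ≡
          (2 + j) * u * (suc j * v) * 1 * x + (2 + j) * suc j * (u * v * 1 * y)
  split = solve-∀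
  final : ∀ a j f y → a * (suc (j + 0) * f) * ((a + suc j + 0 + 2) * y) + (2 + j) * suc j * ((2 + a) * f * y) ≡
          suc a * (suc (j + 0) * f) * (y * (suc (a + suc j + 0 + 2) + j))
  final = solve-∀
-- The subtracted term w P^{a+2} of the recurrence is added on both sides, evaluated by induction,
-- and cancelled. The term with one node less vanishes here, since `more` needs a node.
#tuples-! zero (suc s) (suc a) = +-cancelʳ-≡ (suc s * (1 * 1 * s ! * #tuples (2 + a) 1 s)) _ _ (begin
  1 * 1 * (suc s * s !) * #tuples (suc a) 1 (suc s) + suc s * (1 * 1 * s ! * #tuples (2 + a) 1 s)
    ≡⟨ split₁ s (s !) _ _ ⟩
  suc s * s ! * (#tuples (suc a) 1 (suc s) + #tuples (2 + a) 1 s)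
    ≡⟨ cong (suc s * s ! *_) (trans (#tuples-rec a 0 s) (cong (λ x → #tuples a 1 (suc s) + x + #tuples (3 + a) 1 s) (#tuples-no-nodes (2 + a) s))) ⟩
  suc s * s ! * (#tuples a 1 (suc s) + 0 + #tuples (3 + a) 1 s)
    ≡⟨ split₂ s (s !) _ _ ⟩
  1 * 1 * (suc s * s !) * #tuples a 1 (suc s) + suc s * (1 * 1 * s ! * #tuples (3 + a) 1 s)
    ≡⟨ cong₂ (λ x y → x + suc s * y) (#tuples-! zero (suc s) a) (#tuples-! zero s (3 + a)) ⟩
  a * (suc s * s !) * 1 + suc s * ((3 + a) * s ! * 1)
    ≡⟨ final a s (s !) ⟩
  suc a * (suc s * s !) * 1 + suc s * ((2 + a) * s ! * 1)
    ≡⟨ cong (λ y → suc a * (suc s * s !) * 1 + suc s * y) (#tuples-! zero s (2 + a)) ⟨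
  suc a * (suc s * s !) * 1 + suc s * (1 * 1 * s ! * #tuples (2 + a) 1 s) ∎)
  where
  open ≡-Reasoning
  split₁ : ∀ s f x y → 1 * 1 * (suc s * f) * x + suc s * (1 * 1 * f * y) ≡ suc s * f * (x + y)
  split₁ = solve-∀
  split₂ : ∀ s f x y → suc s * f * (x + 0 + y) ≡ 1 * 1 * (suc s * f) * x + suc s * (1 * 1 * f * y)
  split₂ = solve-∀
  final : ∀ a s f → a * (suc s * f) * 1 + suc s * ((3 + a) * f * 1) ≡ suc a * (suc s * f) * 1 + suc s * ((2 + a) * f * 1)
  final = solve-∀
-- Lowering `j` releases the factor `(2 + j) * suc j` from the factorials, lowering `s` the factor
-- `suc s`. Once all terms are written through `f` and `Y`, a polynomial identity remains.
#tuples-! (suc j) (suc s) (suc a) = +-cancelʳ-≡ (suc s * (W * s ! * #tuples (2 + a) (2 + j) s)) _ _ (begin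
  W * (suc s * s !) * #tuples (suc a) (2 + j) (suc s) + suc s * (W * s ! * #tuples (2 + a) (2 + j) s)
    ≡⟨ split₁ W s (s !) _ _ ⟩
  W * (suc s * s !) * (#tuples (suc a) (2 + j) (suc s) + #tuples (2 + a) (2 + j) s)
    ≡⟨ cong (W * (suc s * s !) *_) (#tuples-rec a (suc j) s) ⟩
  W * (suc s * s !) * (#tuples a (2 + j) (suc s) + #tuples (2 + a) (suc j) (suc s) + #tuples (3 + a) (2 + j) s)
    ≡⟨ split₂ j s (suc j !) (j !) (s !) _ _ _ ⟩
  W * (suc s * s !) * #tuples a (2 + j) (suc s)
    + (2 + j) * suc j * (suc j ! * j ! * (suc s * s !) * #tuples (2 + a) (suc j) (suc s))
    + suc s * (W * s ! * #tuples (3 + a) (2 + j) s)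
    ≡⟨ cong₂ _+_ (cong₂ (λ x y → x + (2 + j) * suc j * y) (#tuples-! (suc j) (suc s) a) (#tuples-! j (suc s) (2 + a)))
         (cong (suc s *_) (#tuples-! (suc j) s (3 + a))) ⟩
  a * (suc j + suc s) ! * (β * Y)
    + (2 + j) * suc j * ((2 + a) * (j + suc s) ! * rise (2 + a + j + 2 * suc s + 2) j)
    + suc s * ((3 + a) * (suc j + s) ! * rise (3 + a + suc j + 2 * s + 2) (suc j))
    ≡⟨ cong₂ _+_ (cong₂ _+_ (cong (λ x → a * x * (β * Y)) fact₂)
         (cong₂ (λ x y → (2 + j) * suc j * ((2 + a) * x * rise y j)) fact₁ (β₁ a j s)))
         (cong (λ y → suc s * ((3 + a) * f * y)) (trans (cong (λ y → rise y (suc j)) (β₂ a j s)) (rise-last (suc β) j))) ⟩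
  a * ((2 + j + s) * f) * (β * Y) + (2 + j) * suc j * ((2 + a) * f * Y) + suc s * ((3 + a) * f * (Y * (suc β + j)))
    ≡⟨ final a j s f Y ⟩
  suc a * ((2 + j + s) * f) * (Y * (suc β + j)) + suc s * ((2 + a) * f * (β * Y))
    ≡⟨ cong₂ (λ x y → suc a * x * y + suc s * ((2 + a) * f * (β * Y))) fact₂ (rise-last (suc β) j) ⟨
  suc a * (suc j + suc s) ! * rise (suc β) (suc j) + suc s * ((2 + a) * (suc j + s) ! * rise β (suc j))
    ≡⟨ cong (λ y → suc a * (suc j + suc s) ! * rise (suc β) (suc j) + suc s * ((2 + a) * (suc j + s) ! * rise y (suc j))) (β₃ a j s) ⟨
  suc a * (suc j + suc s) ! * rise (suc β) (suc j) + suc s * ((2 + a) * (suc j + s) ! * rise (2 + a + suc j + 2 * s + 2) (suc j))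
    ≡⟨ cong (λ y → suc a * (suc j + suc s) ! * rise (suc β) (suc j) + suc s * y) (#tuples-! (suc j) s (2 + a)) ⟨
  suc a * (suc j + suc s) ! * rise (suc β) (suc j) + suc s * (W * s ! * #tuples (2 + a) (2 + j) s) ∎)
  where
  open ≡-Reasoning
  W = suc (suc j) ! * suc j !
  β = a + suc j + 2 * suc s + 2
  Y = rise (suc β) j
  f = (suc j + s) !
  fact₁ : (j + suc s) ! ≡ f
  fact₁ = cong _! (+-suc j s)
  fact₂ : (suc j + suc s) ! ≡ (2 + j + s) * f
  fact₂ = cong (λ x → suc x !) (+-suc j s)
  β₁ : ∀ a j s → 2 + a + j + 2 * suc s + 2 ≡ suc (a + suc j + 2 * suc s + 2)
  β₁ = solve-∀
  β₂ : ∀ a j s → 3 + a + suc j + 2 * s + 2 ≡ suc (a + suc j + 2 * suc s + 2)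
  β₂ = solve-∀
  β₃ : ∀ a j s → 2 + a + suc j + 2 * s + 2 ≡ a + suc j + 2 * suc s + 2
  β₃ = solve-∀
  split₁ : ∀ W s f x y → W * (suc s * f) * x + suc s * (W * f * y) ≡ W * (suc s * f) * (x + y)
  split₁ = solve-∀
  split₂ : ∀ j s u v f x y z → (2 + j) * u * (suc j * v) * (suc s * f) * (x + y + z) ≡
    (2 + j) * u * (suc j * v) * (suc s * f) * x + (2 + j) * suc j * (u * v * (suc s * f) * y)
    + suc s * ((2 + j) * u * (suc j * v) * f * z)
  split₂ = solve-∀
  final : ∀ a j s f y →
    a * ((2 + j + s) * f) * ((a + suc j + 2 * suc s + 2) * y) + (2 + j) * suc j * ((2 + a) * f * y)
      + suc s * ((3 + a) * f * (y * (suc (a + suc j + 2 * suc s + 2) + j))) ≡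
    suc a * ((2 + j + s) * f) * (y * (suc (a + suc j + 2 * suc s + 2) + j))
      + suc s * ((2 + a) * f * ((a + suc j + 2 * suc s + 2) * y))
  final = solve-∀

-- The factor on the left restores the lowest factor missing from `rise` in `#tuples-!`, which
-- completes the numerator of a binomial coefficient.
#tuples-closed : ∀ a i s → (suc a + i + 2 * s) * #tuples (suc a) i s ≡
                 suc a * ((i + s ∸ 1) C s) * ((a + 2 * i + 2 * s) C i)
-- Truncated subtraction makes `0 + 0 ∸ 1` equal to 0, and C(0,0) = 1 agrees with the convention
-- C(-1,0) = 1.
#tuples-closed a zero zero = trans (cong (suc (a + 0 + 0) *_) (#tuples-leaves (suc a))) (arr a)
  where
  arr : ∀ a → suc (a + 0 + 0) * 1 ≡ suc a * 1 * 1
  arr = solve-∀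
#tuples-closed a zero (suc s) = begin
  (suc a + 0 + 2 * suc s) * #tuples (suc a) 0 (suc s) ≡⟨ cong ((suc a + 0 + 2 * suc s) *_) (#tuples-no-nodes (suc a) s) ⟩
  (suc a + 0 + 2 * suc s) * 0                         ≡⟨ *-zeroʳ (suc a + 0 + 2 * suc s) ⟩
  0                                                   ≡⟨ cong (_* ((a + 0 + 2 * suc s) C 0)) (trans (cong (suc a *_) (k>n⇒nCk≡0 (n<1+n s))) (*-zeroʳ (suc a))) ⟨
  suc a * (s C suc s) * ((a + 0 + 2 * suc s) C 0)     ∎
  where open ≡-Reasoning
#tuples-closed a (suc j) s = *-cancelˡ-≡ _ _ K {{K≢0}} (begin
  K * ((suc a + suc j + 2 * s) * #tuples (suc a) (suc j) s) ≡⟨ shuffle₁ K (suc a + suc j + 2 * s) (#tuples (suc a) (suc j) s) ⟩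
  (suc a + suc j + 2 * s) * (K * #tuples (suc a) (suc j) s) ≡⟨ cong ((suc a + suc j + 2 * s) *_) (#tuples-! j s (suc a)) ⟩
  (suc a + suc j + 2 * s) * (suc a * (j + s) ! * rise (suc a + j + 2 * s + 2) j)
    ≡⟨ shuffle₂ (suc a + suc j + 2 * s) (suc a) ((j + s) !) _ ⟩
  suc a * (j + s) ! * ((suc a + suc j + 2 * s) * rise (suc a + j + 2 * s + 2) j)
    ≡⟨ cong (suc a * (j + s) ! *_) (cong₂ (λ x y → x * rise y j) (e₁ a j s) (e₂ a j s)) ⟩
  suc a * (j + s) ! * rise (suc b) (suc j)
    ≡⟨ cong₂ (λ x y → suc a * x * y) (trans (C-! j s) (cong _! (+-comm s j))) (C-rise b (suc j)) ⟨
  suc a * (((s + j) C s) * (s ! * j !)) * (((suc j + b) C suc j) * suc j !)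
    ≡⟨ cong₂ (λ x y → suc a * ((x C s) * (s ! * j !)) * ((y C suc j) * suc j !)) (+-comm s j) (e₃ a j s) ⟩
  suc a * (((j + s) C s) * (s ! * j !)) * (((a + 2 * suc j + 2 * s) C suc j) * suc j !)
    ≡⟨ shuffle₃ (suc a) ((j + s) C s) (s !) (j !) ((a + 2 * suc j + 2 * s) C suc j) (suc j !) ⟩
  K * (suc a * ((j + s) C s) * ((a + 2 * suc j + 2 * s) C suc j)) ∎)
  where
  open ≡-Reasoning
  K = suc j ! * j ! * s !
  K≢0 : NonZero K
  K≢0 = m*n≢0 (suc j ! * j !) (s !) {{suc j !* j !≢0}} {{s !≢0}}
  b = a + suc j + 2 * s
  e₁ : ∀ a j s → suc a + suc j + 2 * s ≡ suc (a + suc j + 2 * s)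
  e₁ = solve-∀
  e₂ : ∀ a j s → suc a + j + 2 * s + 2 ≡ suc (suc (a + suc j + 2 * s))
  e₂ = solve-∀
  e₃ : ∀ a j s → suc j + (a + suc j + 2 * s) ≡ a + 2 * suc j + 2 * s
  e₃ = solve-∀
  shuffle₁ : ∀ x y z → x * (y * z) ≡ y * (x * z)
  shuffle₁ = solve-∀
  shuffle₂ : ∀ x y z t → x * (y * z * t) ≡ y * z * (x * t)
  shuffle₂ = solve-∀
  shuffle₃ : ∀ a c s j d k → a * (c * (s * j)) * (d * k) ≡ k * j * s * (a * c * d)
  shuffle₃ = solve-∀

-- Rational arithmetic and the formula for Q

toℚᵘ-/ : ∀ p d → toℚᵘ (pos p /ℚ suc d) ℚᵘ.≃ mkℚᵘ (pos p) d
toℚᵘ-/ p d = ℚₚ.toℚᵘ-fromℚᵘ (mkℚᵘ (pos p) d)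

fraction : ∀ p d x y t → suc d * t ≡ p * x * y → ((pos p /ℚ suc d) *ℚ ℕtoℚ x) *ℚ ℕtoℚ y ≡ ℕtoℚ t
fraction p d x y t eq = ℚₚ.toℚᵘ-injective (begin
  toℚᵘ (((pos p /ℚ suc d) *ℚ ℕtoℚ x) *ℚ ℕtoℚ y)
    ≈⟨ ℚₚ.toℚᵘ-homo-* ((pos p /ℚ suc d) *ℚ ℕtoℚ x) (ℕtoℚ y) ⟩
  toℚᵘ ((pos p /ℚ suc d) *ℚ ℕtoℚ x) ℚᵘ.* toℚᵘ (ℕtoℚ y)
    ≈⟨ ℚᵘₚ.*-cong (ℚᵘₚ.≃-trans (ℚₚ.toℚᵘ-homo-* (pos p /ℚ suc d) (ℕtoℚ x)) (ℚᵘₚ.*-cong (toℚᵘ-/ p d) (toℚᵘ-/ x 0))) (toℚᵘ-/ y 0) ⟩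
  mkℚᵘ (pos p) d ℚᵘ.* mkℚᵘ (pos x) 0 ℚᵘ.* mkℚᵘ (pos y) 0
    ≈⟨ *≡* cross ⟩
  mkℚᵘ (pos t) 0 ≈⟨ ℚᵘₚ.≃-sym (toℚᵘ-/ t 0) ⟩
  toℚᵘ (ℕtoℚ t) ∎)
  where
  open ≃-Reasoning
  cross : (pos p ℤ.* pos x ℤ.* pos y) ℤ.* pos 1 ≡ pos t ℤ.* pos (suc d * 1 * 1)
  cross = trans (ℤₚ.*-identityʳ _) (trans (cong (ℤ._* pos y) (sym (ℤₚ.pos-* p x))) (trans (sym (ℤₚ.pos-* (p * x) y))
    (trans (cong pos (trans (sym eq) (arr d t))) (ℤₚ.pos-* t _))))
    where
    arr : ∀ d t → suc d * t ≡ t * (suc d * 1 * 1)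
    arr = solve-∀

ℕtoℚ-+ : ∀ m n → ℕtoℚ (m + n) ≡ ℕtoℚ m +ℚ ℕtoℚ n
ℕtoℚ-+ m n = ℚₚ.toℚᵘ-injective (begin
  toℚᵘ (ℕtoℚ (m + n)) ≈⟨ toℚᵘ-/ (m + n) 0 ⟩
  mkℚᵘ (pos (m + n)) 0  ≈⟨ *≡* (cong (ℤ._* pos 1) (cong₂ ℤ._+_ (sym (ℤₚ.*-identityʳ (pos m))) (sym (ℤₚ.*-identityʳ (pos n))))) ⟩
  mkℚᵘ (pos m) 0 ℚᵘ.+ mkℚᵘ (pos n) 0 ≈⟨ ℚᵘₚ.≃-sym (ℚᵘₚ.≃-trans (ℚₚ.toℚᵘ-homo-+ (ℕtoℚ m) (ℕtoℚ n)) (ℚᵘₚ.+-cong (toℚᵘ-/ m 0) (toℚᵘ-/ n 0))) ⟩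
  toℚᵘ (ℕtoℚ m +ℚ ℕtoℚ n) ∎)
  where open ≃-Reasoning

Σ<-cong : ∀ m {f g : ℕ → ℚ} → (∀ k → k < m → f k ≡ g k) → Σ< m f ≡ Σ< m g
Σ<-cong zero h = refl
Σ<-cong (suc m) h = cong₂ _+ℚ_ (Σ<-cong m λ k k<m → h k (m≤n⇒m≤1+n k<m)) (h m ≤-refl)

Σ<-0 : ∀ m {f : ℕ → ℚ} → (∀ k → k < m → f k ≡ 0ℚ) → Σ< m f ≡ 0ℚ
Σ<-0 zero h = refl
Σ<-0 (suc m) h = cong₂ _+ℚ_ (Σ<-0 m λ k k<m → h k (m≤n⇒m≤1+n k<m)) (h m ≤-refl)

Σ<-+ : ∀ m (f g : ℕ → ℚ) → Σ< m (λ k → f k +ℚ g k) ≡ Σ< m f +ℚ Σ< m g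
Σ<-+ zero f g = refl
Σ<-+ (suc m) f g = trans (cong (_+ℚ (f m +ℚ g m)) (Σ<-+ m f g)) (shuffle (Σ< m f) (Σ< m g) (f m) (g m))
  where
  open +-*-Solver
  shuffle : ∀ a b c d → (a +ℚ b) +ℚ (c +ℚ d) ≡ (a +ℚ c) +ℚ (b +ℚ d)
  shuffle = solve 4 (λ a b c d → (a :+ b) :+ (c :+ d) := (a :+ c) :+ (b :+ d)) refl

Σ<-first : ∀ m (f : ℕ → ℚ) → Σ< (suc m) f ≡ f 0 +ℚ Σ< m (λ k → f (suc k))
Σ<-first zero f = ℚₚ.+-comm 0ℚ (f 0)
Σ<-first (suc m) f = trans (cong (_+ℚ f (suc m)) (Σ<-first m f)) (ℚₚ.+-assoc (f 0) _ _)

ℕtoℚ-collect : ∀ {A : Set} m (f : ℕ → List A) → ℕtoℚ (length (collect m f)) ≡ Σ< m (λ k → ℕtoℚ (length (f k)))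
ℕtoℚ-collect zero f = refl
ℕtoℚ-collect (suc m) f = trans (cong ℕtoℚ (length-++ (collect m f)))
  (trans (ℕtoℚ-+ (length (collect m f)) (length (f m))) (cong (_+ℚ ℕtoℚ (length (f m))) (ℕtoℚ-collect m f)))

-- Each entry comes with its own equation, so that the formulas for P and Q, which are full of
-- truncated differences, can be matched entry by entry.
#tuples-fraction : ∀ {d A I X Y} a i s → d ≡ a + i + 2 * s → A ≡ suc a → I ≡ i → X ≡ i + s ∸ 1 → Y ≡ a + 2 * i + 2 * s →
  ((pos A /ℚ suc d) *ℚ ℕtoℚ (X C s)) *ℚ ℕtoℚ (Y C I) ≡ ℕtoℚ (#tuples A I s)
#tuples-fraction a i s refl refl refl refl refl =
  fraction (suc a) (a + i + 2 * s) ((i + s ∸ 1) C s) ((a + 2 * i + 2 * s) C i) (#tuples (suc a) i s) (#tuples-closed a i s)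

Qterm : ℕ → ℕ → ℕ → ℚ
Qterm n k s = ((pos (3 * (k ∸ s) + 2) /ℚ suc (n ∸ s)) *ℚ ℕtoℚ ((n + s ∸ (3 * k + 2)) C s))
                *ℚ ℕtoℚ ((2 * n ∸ (3 * k + s + 1)) C (n ∸ (3 * k + 1)))

-- In terms of `j`, `s`, `i` all truncated differences are polynomials. With `a = 3 * j + 1` the
-- root has `suc a` children, and `n ∸ s` is `a + i + 2 * s`.
Qterm-count : ∀ {n k} j s i → j + s ≡ k → 3 * k + 1 + i ≡ n →
              Qterm n k s ≡ ℕtoℚ (#tuples (3 * (k ∸ s) + 2) (n ∸ (3 * k + 1)) s)
Qterm-count j s i refl refl = #tuples-fraction (3 * j + 1) i s
  (trans (cong (_∸ s) (arr₁ j s i)) (m+n∸n≡m (3 * j + 1 + i + 2 * s) s))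
  (trans (cong (λ x → 3 * x + 2) (m+n∸n≡m j s)) (+-suc (3 * j) 1))
  (m+n∸m≡n (3 * (j + s) + 1) i)
  (trans (cong₂ _∸_ (+-assoc (3 * (j + s) + 1) i s) (sym (+-assoc (3 * (j + s)) 1 1)))
    ([m+n]∸[m+o]≡n∸o (3 * (j + s) + 1) (i + s) 1))
  (trans (cong (_∸ (3 * (j + s) + s + 1)) (arr₂ j s i)) (m+n∸m≡n (3 * (j + s) + s + 1) _))
  where
  arr₁ : ∀ j s i → 3 * (j + s) + 1 + i ≡ 3 * j + 1 + i + 2 * s + s
  arr₁ = solve-∀
  arr₂ : ∀ j s i → 2 * (3 * (j + s) + 1 + i) ≡ 3 * (j + s) + s + 1 + (3 * j + 1 + 2 * i + 2 * s)
  arr₂ = solve-∀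

Qterm-roots : ∀ n k s → s < suc k → 3 * k < n →
              ℕtoℚ (length (rootsWith (3 * (k ∸ s) + 2) (n ∸ (3 * k + 1)) s)) ≡ Qterm n k s
Qterm-roots n k s s≤k 3k<n = trans
  (cong ℕtoℚ (length-map _ (tuples (3 * (k ∸ s) + 2) (n ∸ (3 * k + 1)) s)))
  (sym (Qterm-count (k ∸ s) s (n ∸ (3 * k + 1)) (m∸n+n≡m (≤-pred s≤k))
    (m+[n∸m]≡n (subst (_≤ n) (+-comm 1 (3 * k)) 3k<n))))

Qrow-roots : ∀ n k → ℕtoℚ (length (rootsAt n k)) ≡ (if does (3 * k <? n) then Σ< (suc k) (Qterm n k) else 0ℚ)
Qrow-roots n k = case (3 * k <? n)
  where
  case : Dec (3 * k < n) → ℕtoℚ (length (rootsAt n k)) ≡ (if does (3 * k <? n) then Σ< (suc k) (Qterm n k) else 0ℚ)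
  case (no ¬p) = trans (cong (λ l → ℕtoℚ (length l)) (rootsAt-[] n k ¬p)) (sym (if-false (3 * k <? n) ¬p))
  case (yes p) = trans (cong (λ l → ℕtoℚ (length l)) (rootsAt-collect n k p))
    (trans (trans (ℕtoℚ-collect (suc k) (λ s → rootsWith (3 * (k ∸ s) + 2) (n ∸ (3 * k + 1)) s))
             (Σ<-cong (suc k) λ s s<sk → Qterm-roots n k s s<sk p))
      (sym (if-true (3 * k <? n) p)))

Qformula-count : ∀ n → ℕtoℚ (length (roots n)) ≡ Qformula n
Qformula-count n = trans (ℕtoℚ-collect n (rootsAt n)) (Σ<-cong n λ k _ → Qrow-roots n k)

-- The series P

-- Σ_s f (N - 3 s) s, the coefficient of z^N after x ↦ z, w ↦ z³.
diag : (ℕ → ℕ → ℕ) → ℕ → ℕ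
diag f 0 = f 0 0
diag f 1 = f 1 0
diag f 2 = f 2 0
diag f (suc (suc (suc N))) = f (3 + N) 0 + diag (λ i s → f i (suc s)) N

diag-cong : ∀ {f g} N → (∀ i s → f i s ≡ g i s) → diag f N ≡ diag g N
diag-cong 0 h = h 0 0
diag-cong 1 h = h 1 0
diag-cong 2 h = h 2 0
diag-cong (suc (suc (suc N))) h = cong₂ _+_ (h (3 + N) 0) (diag-cong N λ i s → h i (suc s))

diag-+ : ∀ f g N → diag (λ i s → f i s + g i s) N ≡ diag f N + diag g N
diag-+ f g 0 = refl
diag-+ f g 1 = refl
diag-+ f g 2 = refl
diag-+ f g (suc (suc (suc N))) = trans (cong (λ x → f (3 + N) 0 + g (3 + N) 0 + x) (diag-+ _ _ N)) (shuffle (f (3 + N) 0) _ _ _)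
  where
  shuffle : ∀ a b c d → a + b + (c + d) ≡ a + c + (b + d)
  shuffle = solve-∀

shift : (ℕ → ℕ) → ℕ → ℕ
shift f zero    = 0
shift f (suc N) = f N

-- Multiplication by x and by w, which turn into z and z³ on the diagonal.
shiftˡ shiftʳ : (ℕ → ℕ → ℕ) → ℕ → ℕ → ℕ
shiftˡ f zero    s = 0
shiftˡ f (suc i) s = f i s
shiftʳ f i zero    = 0
shiftʳ f i (suc s) = f i s

diag-shiftˡ : ∀ f N → diag (shiftˡ f) N ≡ shift (diag f) N
diag-shiftˡ f 0 = refl
diag-shiftˡ f 1 = refl
diag-shiftˡ f 2 = refl
diag-shiftˡ f (suc (suc (suc N))) = trans (cong (f (2 + N) 0 +_)
    (trans (diag-cong N λ { zero s → refl ; (suc i) s → refl }) (diag-shiftˡ (λ i s → f i (suc s)) N))) (last N)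
  where
  last : ∀ N → f (2 + N) 0 + shift (diag (λ i s → f i (suc s))) N ≡ diag f (2 + N)
  last zero = +-identityʳ _
  last (suc N) = refl

diag-shiftʳ : ∀ f N → diag (shiftʳ f) N ≡ shift (shift (shift (diag f))) N
diag-shiftʳ f 0 = refl
diag-shiftʳ f 1 = refl
diag-shiftʳ f 2 = refl
diag-shiftʳ f (suc (suc (suc N))) = refl

-- power a and headed a are the coefficient sequences of P^a and P^a (P - 1).
power headed : ℕ → ℕ → ℕ
power  a = diag (#tuples a)
headed a = diag (#heads a)

power-0 : ∀ N → power 0 (suc N) ≡ 0
power-0 0 = refl
power-0 1 = refl
power-0 (suc (suc N)) = diag-vanish N
  where
  -- The only 0-tuple is the empty one, with no `more`; `k` records that the columns reached by now
  -- all have positive second index.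
  diag-vanish : ∀ {k} N → diag (λ i s → #tuples 0 i (suc (k + s))) N ≡ 0
  diag-vanish 0 = refl
  diag-vanish 1 = refl
  diag-vanish 2 = refl
  diag-vanish {k} (suc (suc (suc N))) =
    trans (diag-cong N λ i s → cong (λ t → #tuples 0 i (suc t)) (+-suc k s)) (diag-vanish {suc k} N)

power-suc : ∀ a N → power (suc a) N ≡ power a N + headed a N
power-suc a N = trans (diag-cong N (#tuples-suc a)) (diag-+ (#tuples a) (#heads a) N)

-- The equation of P in the form P - 1 = z P² + z³ P² (P - 1), multiplied by P^a.
headed-rec : ∀ a N → headed a N ≡ shift (power (2 + a)) N + shift (shift (shift (headed (2 + a)))) N
headed-rec a N = trans (diag-cong N rec) (trans (diag-+ (shiftˡ (#tuples (2 + a))) (shiftʳ (#heads (2 + a))) N)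
  (cong₂ _+_ (diag-shiftˡ (#tuples (2 + a)) N) (diag-shiftʳ (#heads (2 + a)) N)))
  where
  rec : ∀ i s → #heads a i s ≡ shiftˡ (#tuples (2 + a)) i s + shiftʳ (#heads (2 + a)) i s
  rec zero zero = refl
  rec zero (suc s) = refl
  rec (suc i) zero = trans (#heads-zero a i) (sym (+-identityʳ _))
  rec (suc i) (suc s) = #heads-suc a i s

-- Convolution of series

⊛-cong : ∀ {f f′ g g′ : Series} n → (∀ i → i ≤ n → f i ≡ f′ i) → (∀ i → i ≤ n → g i ≡ g′ i) → (f ⊛ g) n ≡ (f′ ⊛ g′) n
⊛-cong n hf hg = Σ<-cong (suc n) λ k k≤n → cong₂ _*ℚ_ (hf k (≤-pred k≤n)) (hg (n ∸ k) (m∸n≤m n k))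

⊛-distribʳ : ∀ (f g k : Series) n → ((f ⊕ g) ⊛ k) n ≡ (f ⊛ k) n +ℚ (g ⊛ k) n
⊛-distribʳ f g k n = trans (Σ<-cong (suc n) λ i _ → ℚₚ.*-distribʳ-+ (k (n ∸ i)) (f i) (g i)) (Σ<-+ (suc n) _ _)

⊛-distribˡ : ∀ (f g k : Series) n → (f ⊛ (g ⊕ k)) n ≡ (f ⊛ g) n +ℚ (f ⊛ k) n
⊛-distribˡ f g k n = trans (Σ<-cong (suc n) λ i _ → ℚₚ.*-distribˡ-+ (f i) (g (n ∸ i)) (k (n ∸ i))) (Σ<-+ (suc n) _ _)

⊛-identityˡ : ∀ (f : Series) n → (oneS ⊛ f) n ≡ f n
⊛-identityˡ f n = trans (Σ<-first n (λ i → oneS i *ℚ f (n ∸ i)))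
  (trans (cong₂ _+ℚ_ (ℚₚ.*-identityˡ (f n)) (Σ<-0 n λ k _ → ℚₚ.*-zeroˡ (f (n ∸ suc k)))) (ℚₚ.+-identityʳ (f n)))

⊛-identityʳ : ∀ (f : Series) n → (f ⊛ oneS) n ≡ f n
⊛-identityʳ f n = trans (cong₂ _+ℚ_ (Σ<-0 n vanish) (trans (cong (λ t → f n *ℚ oneS t) (n∸n≡0 n)) (ℚₚ.*-identityʳ (f n)))) (ℚₚ.+-identityˡ (f n))
  where
  vanish : ∀ k → k < n → f k *ℚ oneS (n ∸ k) ≡ 0ℚ
  vanish k k<n rewrite sym (suc-pred (n ∸ k) {{>-nonZero (m<n⇒0<n∸m k<n)}}) = ℚₚ.*-zeroʳ (f k)

⊛-zpowˡ : ∀ k (f g : Series) n → (zpow k f ⊛ g) n ≡ zpow k (f ⊛ g) n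
⊛-zpowˡ zero f g n = refl
⊛-zpowˡ (suc k) f g zero = trans (ℚₚ.+-identityˡ _) (ℚₚ.*-zeroˡ (g 0))
⊛-zpowˡ (suc k) f g (suc n) = trans (Σ<-first (suc n) (λ i → zpow (suc k) f i *ℚ g (suc n ∸ i)))
  (trans (cong (_+ℚ (zpow k f ⊛ g) n) (ℚₚ.*-zeroˡ (g (suc n)))) (trans (ℚₚ.+-identityˡ _) (⊛-zpowˡ k f g n)))

⊛-zpowʳ : ∀ k (f g : Series) n → (f ⊛ zpow k g) n ≡ zpow k (f ⊛ g) n
⊛-zpowʳ zero f g n = refl
⊛-zpowʳ (suc k) f g zero = trans (ℚₚ.+-identityˡ _) (ℚₚ.*-zeroʳ (f 0))
⊛-zpowʳ (suc k) f g (suc n) = trans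
  (cong₂ _+ℚ_ (Σ<-cong (suc n) λ i i≤n → cong (λ t → f i *ℚ zpow (suc k) g t) (+-∸-assoc 1 (≤-pred i≤n)))
    (trans (cong (λ t → f (suc n) *ℚ zpow (suc k) g t) (n∸n≡0 n)) (ℚₚ.*-zeroʳ (f (suc n)))))
  (trans (ℚₚ.+-identityʳ _) (⊛-zpowʳ k f g n))

zpow-cong : ∀ k {f g : Series} → (∀ n → f n ≡ g n) → ∀ n → zpow k f n ≡ zpow k g n
zpow-cong zero h n = h n
zpow-cong (suc k) h zero = refl
zpow-cong (suc k) h (suc n) = zpow-cong k h n

-- The counts as powers of P

powerS headedS : ℕ → Series
powerS  a n = ℕtoℚ (power a n)
headedS a n = ℕtoℚ (headed a n)

powerS-0 : ∀ n → powerS 0 n ≡ oneS n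
powerS-0 zero = refl
powerS-0 (suc n) = cong ℕtoℚ (power-0 n)

powerS-suc : ∀ a n → powerS (suc a) n ≡ (powerS a ⊕ headedS a) n
powerS-suc a n = trans (cong ℕtoℚ (power-suc a n)) (ℕtoℚ-+ (power a n) (headed a n))

headedS-rec : ∀ a n → headedS a n ≡ (zpow 1 (powerS (2 + a)) ⊕ zpow 3 (headedS (2 + a))) n
headedS-rec a n = trans (cong ℕtoℚ (headed-rec a n)) (trans (ℕtoℚ-+ (shift (power (2 + a)) n) _)
  (cong₂ _+ℚ_ (one n) (three n)))
  where
  one : ∀ n → ℕtoℚ (shift (power (2 + a)) n) ≡ zpow 1 (powerS (2 + a)) n
  one zero = refl
  one (suc n) = refl
  three : ∀ n → ℕtoℚ (shift (shift (shift (headed (2 + a)))) n) ≡ zpow 3 (headedS (2 + a)) n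
  three 0 = refl
  three 1 = refl
  three 2 = refl
  three (suc (suc (suc n))) = refl

headedS-⊛ : ∀ a b n → (headedS a ⊛ powerS b) n ≡
            zpow 1 (powerS (2 + a) ⊛ powerS b) n +ℚ zpow 3 (headedS (2 + a) ⊛ powerS b) n
headedS-⊛ a b n = trans (⊛-cong {g = powerS b} n (λ i _ → headedS-rec a i) (λ _ _ → refl))
  (trans (⊛-distribʳ (zpow 1 (powerS (2 + a))) (zpow 3 (headedS (2 + a))) (powerS b) n)
    (cong₂ _+ℚ_ (⊛-zpowˡ 1 (powerS (2 + a)) (powerS b) n) (⊛-zpowˡ 3 (headedS (2 + a)) (powerS b) n)))

-- So far `powerS a` is P^a in name only: it was defined by counting. At fixed `n`, `power-⊛` brings
-- `a` down to 0 through `headed-⊛`, which by `headedS-rec` looks only at smaller `n`; there the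
-- exponent may grow freely.
power-⊛  : ∀ n a b → (powerS a ⊛ powerS b) n ≡ powerS (a + b) n
headed-⊛ : ∀ n a b → (headedS a ⊛ powerS b) n ≡ headedS (a + b) n
power-⊛ n zero b = trans (⊛-cong {g = powerS b} n (λ i _ → powerS-0 i) (λ _ _ → refl)) (⊛-identityˡ (powerS b) n)
power-⊛ n (suc a) b = trans (⊛-cong {g = powerS b} n (λ i _ → powerS-suc a i) (λ _ _ → refl))
  (trans (⊛-distribʳ (powerS a) (headedS a) (powerS b) n)
    (trans (cong₂ _+ℚ_ (power-⊛ n a b) (headed-⊛ n a b)) (sym (powerS-suc (a + b) n))))
headed-⊛ 0 a b = trans (headedS-⊛ a b 0) (sym (headedS-rec (a + b) 0))
headed-⊛ 1 a b = trans (headedS-⊛ a b 1) (trans (cong (_+ℚ 0ℚ) (power-⊛ 0 (2 + a) b)) (sym (headedS-rec (a + b) 1)))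
headed-⊛ 2 a b = trans (headedS-⊛ a b 2) (trans (cong (_+ℚ 0ℚ) (power-⊛ 1 (2 + a) b)) (sym (headedS-rec (a + b) 2)))
headed-⊛ (suc (suc (suc n))) a b = trans (headedS-⊛ a b (3 + n))
  (trans (cong₂ _+ℚ_ (power-⊛ (suc (suc n)) (2 + a) b) (headed-⊛ n (2 + a) b)) (sym (headedS-rec (a + b) (3 + n))))

⊛-neg : ∀ (f g : Series) n → (f ⊛ (λ i → neg (g i))) n ≡ neg ((f ⊛ g) n)
⊛-neg f g n = go (suc n)
  where
  go : ∀ m → Σ< m (λ i → f i *ℚ (neg (g (n ∸ i)))) ≡ neg (Σ< m (λ i → f i *ℚ g (n ∸ i)))
  go zero = refl
  go (suc m) = trans (cong₂ _+ℚ_ (go m) (sym (ℚₚ.neg-distribʳ-* (f m) (g (n ∸ m))))) (sym (ℚₚ.neg-distrib-+ (Σ< m (λ i → f i *ℚ g (n ∸ i))) (f m *ℚ g (n ∸ m))))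

-- Expanding gives (P - 1) - z³ P² (P - 1), and `headedS-rec` at exponent 0 says that this is z P².
powerS-IsP : IsP (powerS 1)
powerS-IsP n = begin
  ((powerS 1 ⊖ oneS) ⊛ (oneS ⊖ zpow 3 (powerS 1 ⊛ powerS 1))) n
    ≡⟨ ⊛-cong {f′ = headedS 0} {g′ = oneS ⊕ (λ i → neg (zpow 3 (powerS 2) i))} n (λ i _ → minus-one i)
         (λ i _ → cong (oneS i -ℚ_) (zpow-cong 3 (λ m → power-⊛ m 1 1) i)) ⟩
  (headedS 0 ⊛ (oneS ⊕ (λ i → neg (zpow 3 (powerS 2) i)))) n
    ≡⟨ ⊛-distribˡ (headedS 0) oneS (λ i → neg (zpow 3 (powerS 2) i)) n ⟩
  (headedS 0 ⊛ oneS) n +ℚ (headedS 0 ⊛ (λ i → neg (zpow 3 (powerS 2) i))) n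
    ≡⟨ cong₂ _+ℚ_ (trans (⊛-identityʳ (headedS 0) n) (headedS-rec 0 n))
         (trans (⊛-neg (headedS 0) (zpow 3 (powerS 2)) n) (cong neg (trans (⊛-zpowʳ 3 (headedS 0) (powerS 2) n)
           (zpow-cong 3 (λ m → headed-⊛ m 0 2) n)))) ⟩
  (zpow 1 (powerS 2) n +ℚ zpow 3 (headedS 2) n) -ℚ zpow 3 (headedS 2) n
    ≡⟨ cancel (zpow 1 (powerS 2) n) (zpow 3 (headedS 2) n) ⟩
  zpow 1 (powerS 2) n
    ≡⟨ zpow-cong 1 (λ m → power-⊛ m 1 1) n ⟨
  zpow 1 (powerS 1 ⊛ powerS 1) n ∎
  where
  open ≡-Reasoning
  open +-*-Solver
  cancel : ∀ a b → (a +ℚ b) -ℚ b ≡ a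
  cancel = solve 2 (λ a b → (a :+ b) :- b := a) refl
  cancel′ : ∀ a b → (a +ℚ b) -ℚ a ≡ b
  cancel′ = solve 2 (λ a b → (a :+ b) :- a := b) refl
  minus-one : ∀ i → powerS 1 i -ℚ oneS i ≡ headedS 0 i
  minus-one i = trans (cong₂ _-ℚ_ (powerS-suc 0 i) (sym (powerS-0 i))) (cancel′ (powerS 0 i) (headedS 0 i))

-- Uniqueness of P and its coefficients

zpow-agree : ∀ k {f g : Series} {n} → (∀ j → j < n → f j ≡ g j) → ∀ m → m ≤ n → zpow (suc k) f m ≡ zpow (suc k) g m
zpow-agree k h zero _ = refl
zpow-agree zero h (suc m) m<n = h m m<n
zpow-agree (suc k) h (suc m) m<n = zpow-agree k h m (<⇒≤ m<n)

-- In the coefficient of z^n the unknown `P n` occurs only in the last summand on the left, with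
-- factor 1 - 0. Everything else, the right side included, involves earlier coefficients because of
-- the powers of z.
IsP-unique : ∀ (P R : Series) → IsP P → IsP R → ∀ n → P n ≡ R n
IsP-unique P R isP isR = <-rec (λ n → P n ≡ R n) step
  where
  step : ∀ n → (∀ {j} → j < n → P j ≡ R j) → P n ≡ R n
  step n h = begin
    P n                                        ≡⟨ add-one (P n) (oneS n) ⟨
    (P n -ℚ oneS n) *ℚ (1ℚ -ℚ 0ℚ) +ℚ oneS n    ≡⟨ cong (_+ℚ oneS n) heads≡ ⟩
    (R n -ℚ oneS n) *ℚ (1ℚ -ℚ 0ℚ) +ℚ oneS n    ≡⟨ add-one (R n) (oneS n) ⟩
    R n ∎
    where
    open ≡-Reasoning
    add-one : ∀ a b → (a -ℚ b) *ℚ (1ℚ -ℚ 0ℚ) +ℚ b ≡ a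
    add-one = solve 2 (λ a b → (a :- b) :* (con 1ℚ :- con 0ℚ) :+ b := a) refl
      where open +-*-Solver
    square : ∀ j → j < n → (P ⊛ P) j ≡ (R ⊛ R) j
    square j j<n = ⊛-cong j (λ i i≤j → h (≤-trans (s≤s i≤j) j<n)) (λ i i≤j → h (≤-trans (s≤s i≤j) j<n))
    factor : Series → Series
    factor X = oneS ⊖ zpow 3 (X ⊛ X)
    lower : Series → ℚ
    lower X = Σ< n (λ i → (X ⊖ oneS) i *ℚ factor X (n ∸ i))
    lower≡ : lower P ≡ lower R
    lower≡ = Σ<-cong n λ i i<n → cong₂ _*ℚ_ (cong (_-ℚ oneS i) (h i<n))
      (cong (oneS (n ∸ i) -ℚ_) (zpow-agree 2 square (n ∸ i) (m∸n≤m n i)))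
    total≡ : lower P +ℚ (P n -ℚ oneS n) *ℚ factor P (n ∸ n) ≡ lower R +ℚ (R n -ℚ oneS n) *ℚ factor R (n ∸ n)
    total≡ = trans (isP n) (trans (zpow-agree 0 square n ≤-refl) (sym (isR n)))
    heads≡ : (P n -ℚ oneS n) *ℚ (1ℚ -ℚ 0ℚ) ≡ (R n -ℚ oneS n) *ℚ (1ℚ -ℚ 0ℚ)
    heads≡ = ∙-cancelˡ ℚₚ.+-0-group (lower R) _ _ (trans
      (cong₂ _+ℚ_ (sym lower≡) (cong (λ t → (P n -ℚ oneS n) *ℚ factor P t) (sym (n∸n≡0 n))))
      (trans total≡ (cong (λ t → lower R +ℚ (R n -ℚ oneS n) *ℚ factor R t) (n∸n≡0 n))))

-- `diag` also contains the boundary term `f 0 k` with 3k = N, which the sum over 3k < N omits; the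
-- first two hypotheses make it vanish. Shifting the second index turns the first of them into both.
diag-Σ< : ∀ f m N → (∀ s → f 0 (suc s) ≡ 0) → (N ≡ 0 → f 0 0 ≡ 0) → N ≤ m →
          Σ< m (λ k → if does (3 * k <? N) then ℕtoℚ (f (N ∸ 3 * k) k) else 0ℚ) ≡ ℕtoℚ (diag f N)
diag-Σ< f m 0 h h₀ _ = trans (Σ<-0 m λ k _ → refl) (cong ℕtoℚ (sym (h₀ refl)))
diag-Σ< f (suc m) 1 h h₀ _ = trans (Σ<-first m _)
  (trans (cong (ℕtoℚ (f 1 0) +ℚ_) (Σ<-0 m λ k _ → refl)) (ℚₚ.+-identityʳ _))
diag-Σ< f (suc m) 2 h h₀ _ = trans (Σ<-first m _)
  (trans (cong (ℕtoℚ (f 2 0) +ℚ_) (Σ<-0 m λ k _ → if-false (3 * suc k <? 2) λ lt →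
    contradiction (≤-trans (s≤s (*-monoʳ-≤ 3 (s≤s (z≤n {k})))) lt) λ { (s≤s (s≤s ())) })) (ℚₚ.+-identityʳ _))
diag-Σ< f (suc m) (suc (suc (suc N))) h h₀ (s≤s N≤m) = trans (Σ<-first m _)
  (trans (cong (ℕtoℚ (f (3 + N) 0) +ℚ_) (trans (Σ<-cong m λ k _ → reindex k)
      (diag-Σ< (λ i s → f i (suc s)) m N (λ s → h (suc s)) (λ _ → h 0) (≤-trans (m≤n+m N 2) N≤m))))
    (sym (ℕtoℚ-+ (f (3 + N) 0) _)))
  where
  reindex : ∀ k → (if does (3 * suc k <? 3 + N) then ℕtoℚ (f (3 + N ∸ 3 * suc k) (suc k)) else 0ℚ) ≡
                  (if does (3 * k <? N) then ℕtoℚ (f (N ∸ 3 * k) (suc k)) else 0ℚ)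
  reindex k = case (3 * k <? N)
    where
    case : Dec (3 * k < N) → (if does (3 * suc k <? 3 + N) then ℕtoℚ (f (3 + N ∸ 3 * suc k) (suc k)) else 0ℚ) ≡
                  (if does (3 * k <? N) then ℕtoℚ (f (N ∸ 3 * k) (suc k)) else 0ℚ)
    case (yes p) = trans (if-true (3 * suc k <? 3 + N) (≤-trans (≤-reflexive (cong suc (*-suc 3 k))) (+-monoʳ-≤ 3 p)))
      (trans (cong (λ t → ℕtoℚ (f (3 + N ∸ t) (suc k))) (*-suc 3 k)) (sym (if-true (3 * k <? N) p)))
    case (no ¬p) = trans (if-false (3 * suc k <? 3 + N) λ lt → ¬p (+-cancelˡ-≤ 3 _ _ (≤-trans (≤-reflexive (sym (cong suc (*-suc 3 k)))) lt)))
      (sym (if-false (3 * k <? N) ¬p))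

Pterm-count : ∀ n k → 3 * k < n →
  ((pos 1 /ℚ suc (n ∸ k)) *ℚ ℕtoℚ ((n ∸ 2 * k ∸ 1) C k)) *ℚ ℕtoℚ ((2 * n ∸ 4 * k) C (n ∸ 3 * k)) ≡
  ℕtoℚ (#tuples 1 (n ∸ 3 * k) k)
Pterm-count n k 3k<n = #tuples-fraction 0 (n ∸ 3 * k) k
  (trans (cong (_∸ k) (trans n≡ (arr₁ i k))) (m+n∸n≡m (i + 2 * k) k))
  refl refl
  (cong (_∸ 1) (trans (cong (_∸ 2 * k) (trans n≡ (arr₂ i k))) (m+n∸n≡m (i + k) (2 * k))))
  (trans (cong (λ t → 2 * t ∸ 4 * k) n≡) (trans (cong (_∸ 4 * k) (arr₃ i k)) (m+n∸n≡m (2 * i + 2 * k) (4 * k))))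
  where
  i = n ∸ 3 * k
  n≡ : n ≡ i + 3 * k
  n≡ = sym (m∸n+n≡m (<⇒≤ 3k<n))
  arr₁ : ∀ i k → i + 3 * k ≡ i + 2 * k + k
  arr₁ = solve-∀
  arr₂ : ∀ i k → i + 3 * k ≡ i + k + 2 * k
  arr₂ = solve-∀
  arr₃ : ∀ i k → 2 * (i + 3 * k) ≡ 2 * i + 2 * k + 4 * k
  arr₃ = solve-∀

Pformula-power : ∀ n → 0 < n → powerS 1 n ≡ Pformula n
Pformula-power n 0<n = trans
  (sym (diag-Σ< (#tuples 1) n n (#tuples-no-nodes 1) (λ { refl → contradiction 0<n λ () }) ≤-refl))
  (Σ<-cong n λ k _ → term k (3 * k <? n))
  where
  term : ∀ k → Dec (3 * k < n) → (if does (3 * k <? n) then ℕtoℚ (#tuples 1 (n ∸ 3 * k) k) else 0ℚ) ≡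
    (if does (3 * k <? n) then ((pos 1 /ℚ suc (n ∸ k)) *ℚ ℕtoℚ ((n ∸ 2 * k ∸ 1) C k)) *ℚ ℕtoℚ ((2 * n ∸ 4 * k) C (n ∸ 3 * k)) else 0ℚ)
  term k (yes p) = trans (if-true (3 * k <? n) p) (trans (sym (Pterm-count n k p)) (sym (if-true (3 * k <? n) p)))
  term k (no ¬p) = trans (if-false (3 * k <? n) ¬p) (sym (if-false (3 * k <? n) ¬p))

theorem2p4 : (P : Series) → IsP P → (n : ℕ) → 0 < n →
    (P n ≡ Pformula n) × (Σ ℕ λ q → IsQ n q × ℕtoℚ q ≡ Qformula n)
theorem2p4 P isP n 0<n =
  trans (IsP-unique P (powerS 1) isP powerS-IsP n) (Pformula-power n 0<n) ,
  length (roots n) ,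
  subst (λ N → HasCount (λ (a : Vec ℕ N) → ∃ λ (D : Dissection N) → ThreePeriodic D × IsQuiddity D a) (length (roots n)))
    (+-comm 2 n) (quiddity-count n 0<n) ,
  Qformula-count n
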